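{- Let $r$, $s\ge 1$ be integers and let $G$ be a graph with chromatic number $\chi(G)=k$, where $2<k<r$. Then, as $n\to\infty$, $$\mathrm{ex}_r(n,\{G^r,M_{s+1}^r\})=(1+o(1))\min\{m(G)-1,s\}\binom{n}{r-1}.$$
   Context: For a graph $G$, its $r$-expansion $G^r$ is the $r$-graph obtained from $G$ by adding $r-2$ new vertices to each edge of $G$, all these $(r-2)|E(G)|$ new vertices being distinct from each other and from $V(G)$. $M_{s+1}^r$ is the $r$-graph consisting of $s+1$ pairwise disjoint hyperedges. $\mathrm{ex}_r(n,\mathcal{F})$ is the maximum number of hyperedges in an $n$-vertex $r$-graph containing no member of $\mathcal{F}$ as a subhypergraph. For a graph $G$, $m(G)$ is the minimum of $|W|+|Z|$ over all independent sets $W\subseteq V(G)$, where $Z$ is the set of edges of $G$ not incident to any vertex of $W$. The $o(1)$ is as $n\to\infty$ with $G,r,s$ fixed. -}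

module Defs where

open import Data.Nat using (ℕ; zero; suc; _+_; _*_; _∸_; _≤_)
open import Data.Bool using (Bool; true; false; _∧_; _∨_; not)
open import Data.Fin using (Fin; zero; suc; splitAt; remQuot)
open import Data.Fin.Properties using () renaming (_≟_ to _≟F_)
open import Data.Fin.Subset using (Subset; ∣_∣)
open import Data.Vec using (tabulate; lookup)
open import Data.List using (List; length)
open import Data.List.Membership.Propositional using (_∈_)
open import Data.List.Relation.Unary.All using (All)
open import Data.List.Relation.Unary.Unique.Propositional using (Unique)
open import Data.Product using (Σ; ∃; ∃-syntax; _×_; _,_; proj₁; proj₂; swap)
open import Data.Sum using (_⊎_; inj₁; inj₂)
open import Data.Empty using (⊥)
open import Relation.Nullary using (¬_)
open import Relation.Nullary.Decidable using (⌊_⌋)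
open import Relation.Binary.PropositionalEquality using (_≡_; _≢_)
open import Function.Definitions using (Injective)

anyF : ∀ {p} → (Fin p → Bool) → Bool
anyF {zero} f = false
anyF {suc p} f = f zero ∨ anyF (λ x → f (suc x))

record Graph : Set where
  field
    v : ℕ
    e : ℕ
    ends : Fin e → Fin v × Fin v
    loopless : ∀ i → proj₁ (ends i) ≢ proj₂ (ends i)
    noMulti : ∀ i j → (ends i ≡ ends j ⊎ ends i ≡ swap (ends j)) → i ≡ j
open Graph public

Colorable : Graph → ℕ → Set
Colorable G c = Σ (Fin (v G) → Fin c) λ col →
  ∀ i → col (proj₁ (ends G i)) ≢ col (proj₂ (ends G i))

ChromaticNumber : Graph → ℕ → Set
ChromaticNumber G k = Colorable G k × (∀ c → c Data.Nat.< k → ¬ Colorable G c)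
  where import Data.Nat

Independent : (G : Graph) → Subset (v G) → Set
Independent G W =
  ∀ i → ¬ (lookup W (proj₁ (ends G i)) ≡ true × lookup W (proj₂ (ends G i)) ≡ true)

mCost : (G : Graph) → Subset (v G) → ℕ
mCost G W = ∣ W ∣ + ∣ tabulate (λ i → not (lookup W (proj₁ (ends G i)) ∨ lookup W (proj₂ (ends G i)))) ∣

IsM : Graph → ℕ → Set
IsM G m = (∃[ W ] (Independent G W × mCost G W ≡ m))
        × (∀ W → Independent G W → m ≤ mCost G W)

record RGraph (r n : ℕ) : Set where
  field
    edges : List (Subset n)
    unique : Unique edges
    uniform : All (λ E → ∣ E ∣ ≡ r) edges
open RGraph public

record Pattern : Set where
  field
    pv : ℕ
    pm : ℕ
    pedge : Fin pm → Subset pv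
open Pattern public

image : ∀ {p n} → (Fin p → Fin n) → Subset p → Subset n
image φ S = tabulate (λ y → anyF (λ x → lookup S x ∧ ⌊ φ x ≟F y ⌋))

Contains : ∀ {r n} → RGraph r n → Pattern → Set
Contains H F = Σ (Fin (pv F) → Fin _) λ φ →
  Injective _≡_ _≡_ φ × (∀ i → image φ (pedge F i) ∈ edges H)

-- r-expansion G^r: vertices Fin (v + e*(r-2)); the new vertices of
-- edge i are those z in the second block with quotient i.
expansion : Graph → ℕ → Pattern
expansion G r = record
  { pv = v G + e G * (r ∸ 2)
  ; pm = e G
  ; pedge = λ i → tabulate (λ y → mem i (splitAt (v G) y))
  }
  where
  mem : Fin (e G) → Fin (v G) ⊎ Fin (e G * (r ∸ 2)) → Bool
  mem i (inj₁ x) = ⌊ x ≟F proj₁ (ends G i) ⌋ ∨ ⌊ x ≟F proj₂ (ends G i) ⌋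
  mem i (inj₂ z) = ⌊ proj₁ (remQuot (r ∸ 2) z) ≟F i ⌋

matching : ℕ → ℕ → Pattern
matching t r = record
  { pv = t * r ; pm = t
  ; pedge = λ i → tabulate (λ y → ⌊ proj₁ (remQuot r y) ≟F i ⌋) }

Free2 : ∀ {r n} → RGraph r n → Pattern → Pattern → Set
Free2 H F₁ F₂ = ¬ Contains H F₁ × ¬ Contains H F₂

IsEx2 : (r n : ℕ) → Pattern → Pattern → ℕ → Set
IsEx2 r n F₁ F₂ ex =
  (Σ (RGraph r n) λ H → Free2 H F₁ F₂ × length (edges H) ≡ ex)
  × (∀ (H : RGraph r n) → Free2 H F₁ F₂ → length (edges H) ≤ ex)

module Submission where

-- Lower bound: for c = min (m(G) − 1, s), take all r-sets meeting a fixed c-set S in exactly one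
-- vertex. A matching uses a different vertex of S for each edge, and a copy of G^r meeting S
-- yields an independent set W (the vertices of G in S) with |W| + |Z| ≤ |S|.
--
-- Upper bound: without M_{s+1} a bounded set T covers all edges. If there are more than
-- (1 + ε) c C(n, r−1) edges, a positive fraction of the (r−1)-sets lies in the link of more than c
-- vertices of T, and by pigeonhole in the common link of c + 1 fixed ones. As in Erdős' theorem
-- this dense common link contains a complete (r−1)-partite hypergraph with large parts, so the
-- hypergraph contains the complete r-partite hypergraph with one part of size c + 1 and the
-- others large. If c = s this contains M_{s+1}. If c = m(G) − 1 it contains G^r: vertices of an
-- optimal W and one new vertex of each edge in Z go to the small part, and since χ(G) < r a
-- proper colouring distributes the remaining vertices over the other r − 1 parts.

open import Defs
open import Data.Bool using (Bool; true; false; _∧_; _∨_; not)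
open import Data.Bool.Properties using (∧-conicalˡ; ∧-conicalʳ; ∨-zeroʳ; ⇔→≡) renaming (_≟_ to _≟B_)
open import Data.Empty using (⊥; ⊥-elim)
open import Data.Fin using (Fin; zero; suc; lift; toℕ; fromℕ<; combine; remQuot; inject≤; splitAt; join; _↑ˡ_; _↑ʳ_; punchIn; punchOut)
open import Data.Fin.Properties using (lift-injective; combine-remQuot; remQuot-combine; combine-injectiveˡ; toℕ-fromℕ<; inject≤-injective; all?; ¬∀⟶∃¬; splitAt-↑ˡ; splitAt-↑ʳ; splitAt-join; join-splitAt; punchIn-injective; punchInᵢ≢i; punchIn-punchOut; ↑ˡ-injective; ↑ʳ-injective; injective⇒≤) renaming (suc-injective to sucF-injective; _≟_ to _≟F_; any? to anyᶠ?)
open import Data.Fin.Subset using (Subset; ∣_∣; ⁅_⁆)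
open import Data.Fin.Subset.Properties using (x∈⁅x⁆; x∈⁅y⁆⇒x≡y; ∣⁅x⁆∣≡1)
open import Data.List using (List; []; _∷_; _++_; length; concat; map; cartesianProductWith; allFin)
open import Data.List.Membership.Propositional using (_∈_; find; lose)
open import Data.List.Membership.Propositional.Properties using (∈-map⁺; ∈-map⁻; ∈-++⁺ˡ; ∈-++⁺ʳ; ∈-++⁻; ∈-cartesianProductWith⁻)
open import Data.List.Properties using (length-++; length-map; length-tabulate)
open import Data.List.Relation.Unary.All as All using (All)
open import Data.List.Relation.Unary.AllPairs using ([]; _∷_)
open import Data.List.Relation.Unary.Any using (here; there; any?)
open import Data.List.Relation.Unary.Unique.Propositional using (Unique)
import Data.List.Relation.Unary.Unique.Propositional.Properties as Unique
open import Data.Nat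
open import Data.Nat.Combinatorics using (_C_; nCk+nC[k+1]≡[n+1]C[k+1])
open import Data.Nat.Properties
open import Algebra.Properties.Semiring.Sum +-*-semiring using (sum; ∑-distrib-+; *-distribˡ-sum; sum-cong-≗)
open import Data.Nat.Tactic.RingSolver using (solve-∀)
open import Data.Product using (Σ; ∃-syntax; _×_; _,_; proj₁; proj₂; uncurry)
open import Data.Sum using (_⊎_; inj₁; inj₂; [_,_]′)
open import Data.Sum.Properties using (inj₁-injective; inj₂-injective)
open import Data.Vec using (Vec; []; _∷_; tabulate; lookup; _[_]≔_) renaming (_++_ to _++ᵛ_)
open import Data.Vec.Properties using (lookup∘tabulate; tabulate∘lookup; tabulate-cong; lookup∘update; lookup∘update′; []≔-idempotent; []≔-lookup; ≡-dec; ∷-injectiveʳ; lookup-++ˡ; ++-injective; []=⇒lookup; lookup⇒[]=)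
open import Function using (_∘_)
open import Function.Bundles using (mk⇔)
open import Function.Definitions using (Injective)
open import Relation.Binary.Definitions using (DecidableEquality)
open import Relation.Binary.PropositionalEquality
open import Relation.Nullary using (¬_; Dec; yes; no; contradiction)
open import Relation.Nullary.Decidable using (⌊_⌋; _→-dec_)

private variable
  A B V : Set

-- Binomial coefficients

-- The absorption identity, by induction on `n` with Pascal's rule, so that no division enters.
k*nCk : ∀ n k → suc k * (suc n C suc k) ≡ suc n * (n C k)
k*nCk n zero = lemma n where
  lemma : ∀ n → 1 * (suc n C 1) ≡ suc n * (n C 0)
  lemma zero = refl
  lemma (suc n) = begin
    1 * (suc (suc n) C 1)             ≡⟨ cong (1 *_) (nCk+nC[k+1]≡[n+1]C[k+1] (suc n) 0) ⟨
    1 * ((suc n C 0) + (suc n C 1))   ≡⟨ *-distribˡ-+ 1 (suc n C 0) (suc n C 1) ⟩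
    1 * 1 + 1 * (suc n C 1)           ≡⟨ cong (1 +_) (lemma n) ⟩
    1 + suc n * 1                     ∎
    where open ≡-Reasoning
k*nCk zero (suc k) = trans (*-zeroʳ (suc (suc k))) refl
k*nCk (suc n) (suc k) = begin
  suc (suc k) * (suc (suc n) C suc (suc k))
    ≡⟨ cong (suc (suc k) *_) (nCk+nC[k+1]≡[n+1]C[k+1] (suc n) (suc k)) ⟨
  suc (suc k) * (x + y)
    ≡⟨ expand k x y ⟩
  x + (suc k * x + suc (suc k) * y)
    ≡⟨ cong (x +_) (cong₂ _+_ (k*nCk n k) (k*nCk n (suc k))) ⟩
  x + (suc n * (n C k) + suc n * (n C suc k))
    ≡⟨ cong (x +_) (*-distribˡ-+ (suc n) (n C k) (n C suc k)) ⟨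
  x + suc n * ((n C k) + (n C suc k))
    ≡⟨ cong (λ z → x + suc n * z) (nCk+nC[k+1]≡[n+1]C[k+1] n k) ⟩
  suc (suc n) * x ∎
  where
  open ≡-Reasoning
  x = suc n C suc k
  y = suc n C suc (suc k)
  expand : ∀ k x y → suc (suc k) * (x + y) ≡ x + (suc k * x + suc (suc k) * y)
  expand = solve-∀

-- By Pascal's rule this amounts to a C(m, q-1) ≤ C(m, q), which follows from the absorption
-- identity and (a + 1) q ≤ m + 1.
C-step : ∀ a m q → suc a * q ≤ suc m → a * (suc m C q) ≤ suc a * (m C q)
C-step a m zero _ = *-monoˡ-≤ 1 (n≤1+n a)
C-step a m (suc q) h = begin
  a * (suc m C suc q)            ≡⟨ cong (a *_) (nCk+nC[k+1]≡[n+1]C[k+1] m q) ⟨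
  a * (x + y)                    ≡⟨ *-distribˡ-+ a x y ⟩
  a * x + a * y                  ≤⟨ +-monoˡ-≤ (a * y) ax≤y ⟩
  suc a * y ∎
  where
  open ≤-Reasoning
  x = m C q
  y = m C suc q
  reorder : ∀ q a x → suc q * (suc a * x) ≡ suc a * suc q * x
  reorder = solve-∀
  ax≤y : a * x ≤ y
  ax≤y = +-cancelˡ-≤ x _ _ (*-cancelˡ-≤ (suc q) (begin
    suc q * (suc a * x)      ≡⟨ reorder q a x ⟩
    suc a * suc q * x        ≤⟨ *-monoˡ-≤ x h ⟩
    suc m * x                ≡⟨ k*nCk m q ⟨
    suc q * (suc m C suc q)  ≡⟨ cong (suc q *_) (nCk+nC[k+1]≡[n+1]C[k+1] m q) ⟨
    suc q * (x + y)          ∎))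

-- The factors (a+1)/a, ..., (a+j)/(a+j-1) from `C-step` telescope. Used to show that removing
-- boundedly many vertices changes C(n, q) only by a factor close to 1.
C-shift : ∀ a j m q → (a + j) * q ≤ suc m → a * ((j + m) C q) ≤ (a + j) * (m C q)
C-shift a zero m q _ = ≤-reflexive (cong (_* (m C q)) (sym (+-identityʳ a)))
C-shift a (suc j) m q h = begin
  a * ((suc j + m) C q)      ≡⟨ cong (λ z → a * (z C q)) (+-suc j m) ⟨
  a * ((j + suc m) C q)      ≤⟨ C-shift a j (suc m) q (≤-trans (≤-trans (*-monoˡ-≤ q (n≤1+n (a + j))) h′) (n≤1+n _)) ⟩
  (a + j) * (suc m C q)      ≤⟨ C-step (a + j) m q h′ ⟩
  suc (a + j) * (m C q)      ≡⟨ cong (_* (m C q)) (+-suc a j) ⟨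
  (a + suc j) * (m C q)      ∎
  where
  open ≤-Reasoning
  h′ = subst (λ z → z * q ≤ suc m) (+-suc a j) h

-- The right side is the product (n + 1) ⋯ (n + q).
n^q≤q!*C : ∀ n q → n ^ q ≤ q ! * ((q + n) C q)
n^q≤q!*C n zero = ≤-refl
n^q≤q!*C n (suc q) = begin
  n * n ^ q                                    ≤⟨ *-mono-≤ (m≤n⇒m≤1+n (m≤n+m n q)) (n^q≤q!*C n q) ⟩
  suc (q + n) * (q ! * ((q + n) C q))          ≡⟨ swap* (suc (q + n)) (q !) ((q + n) C q) ⟩
  q ! * (suc (q + n) * ((q + n) C q))          ≡⟨ cong (q ! *_) (k*nCk (q + n) q) ⟨
  q ! * (suc q * ((suc q + n) C suc q))        ≡⟨ swap*′ (q !) (suc q) ((suc q + n) C suc q) ⟩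
  suc q ! * ((suc q + n) C suc q)              ∎
  where
  open ≤-Reasoning
  swap* : ∀ a b c → a * (b * c) ≡ b * (a * c)
  swap* = solve-∀
  swap*′ : ∀ a b c → a * (b * c) ≡ b * a * c
  swap*′ = solve-∀

^-distribʳ-* : ∀ q a b → (a * b) ^ q ≡ a ^ q * b ^ q
^-distribʳ-* zero a b = refl
^-distribʳ-* (suc q) a b = trans (cong (a * b *_) (^-distribʳ-* q a b)) (interchange a b (a ^ q) (b ^ q))
  where
  interchange : ∀ a b c d → a * b * (c * d) ≡ a * c * (b * d)
  interchange = solve-∀

-- Since n - q ≥ n/2, the q-sets are at least a constant proportion of the q-tuples in number, so
-- densities can pass from sets to tuples.
n^q≤K*C : ∀ q n → 2 * q ≤ n → n ^ q ≤ 2 ^ q * q ! * (n C q)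
n^q≤K*C q n 2q≤n = begin
  n ^ q                          ≤⟨ ^-monoˡ-≤ q n≤2m ⟩
  (2 * m) ^ q                    ≡⟨ ^-distribʳ-* q 2 m ⟩
  2 ^ q * m ^ q                  ≤⟨ *-monoʳ-≤ (2 ^ q) (n^q≤q!*C m q) ⟩
  2 ^ q * (q ! * ((q + m) C q))  ≡⟨ *-assoc (2 ^ q) (q !) _ ⟨
  2 ^ q * q ! * ((q + m) C q)    ≡⟨ cong (λ z → 2 ^ q * q ! * (z C q)) q+m≡n ⟩
  2 ^ q * q ! * (n C q)          ∎
  where
  open ≤-Reasoning
  m = n ∸ q
  q+q≤n : q + q ≤ n
  q+q≤n = ≤-trans (+-monoʳ-≤ q (m≤m+n q 0)) 2q≤n
  q+m≡n : q + m ≡ n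
  q+m≡n = m+[n∸m]≡n (≤-trans (m≤m+n q q) q+q≤n)
  n≤2m : n ≤ 2 * m
  n≤2m = begin
    n      ≡⟨ q+m≡n ⟨
    q + m  ≤⟨ +-monoˡ-≤ m (+-cancelˡ-≤ q _ _ (≤-trans q+q≤n (≤-reflexive (sym q+m≡n)))) ⟩
    m + m  ≤⟨ +-monoʳ-≤ m (m≤m+n m 0) ⟩
    2 * m  ∎

-- Sums and counting

sum-mono : ∀ {n} {f g : Fin n → ℕ} → (∀ i → f i ≤ g i) → sum f ≤ sum g
sum-mono {zero} h = z≤n
sum-mono {suc n} h = +-mono-≤ (h zero) (sum-mono (h ∘ suc))

sum-const : ∀ n b → sum {n} (λ _ → b) ≡ n * b
sum-const zero b = refl
sum-const (suc n) b = cong (b +_) (sum-const n b)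

term≤sum : ∀ {n} (f : Fin n → ℕ) i → f i ≤ sum f
term≤sum f zero = m≤m+n (f zero) _
term≤sum f (suc i) = ≤-trans (term≤sum (f ∘ suc) i) (m≤n+m _ (f zero))

indicator : Bool → ℕ
indicator true = 1
indicator false = 0

count : (V → Bool) → List V → ℕ
count p [] = 0
count p (x ∷ xs) = indicator (p x) + count p xs

indicator-mono : ∀ a b → (a ≡ true → b ≡ true) → indicator a ≤ indicator b
indicator-mono false b h = z≤n
indicator-mono true b h rewrite h refl = ≤-refl

count-mono∈ : ∀ {p q : V → Bool} xs → (∀ x → x ∈ xs → p x ≡ true → q x ≡ true) → count p xs ≤ count q xs
count-mono∈ [] h = z≤n
count-mono∈ {p = p} {q} (x ∷ xs) h =
  +-mono-≤ (indicator-mono (p x) (q x) (h x (here refl))) (count-mono∈ xs (λ y y∈ → h y (there y∈)))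

count-mono : ∀ {p q : V → Bool} xs → (∀ x → p x ≡ true → q x ≡ true) → count p xs ≤ count q xs
count-mono xs h = count-mono∈ xs (λ x _ → h x)

count-true : (xs : List V) → count (λ _ → true) xs ≡ length xs
count-true [] = refl
count-true (x ∷ xs) = cong suc (count-true xs)

count-split : ∀ (p q : V → Bool) xs → count p xs ≡ count (λ x → p x ∧ q x) xs + count (λ x → p x ∧ not (q x)) xs
count-split p q [] = refl
count-split p q (x ∷ xs) = begin
  indicator (p x) + count p xs                 ≡⟨ cong₂ _+_ (split (p x) (q x)) (count-split p q xs) ⟩
  (i + j) + (c + d)                            ≡⟨ +-interchange i j c d ⟩
  (i + c) + (j + d)                            ∎
  where
  open ≡-Reasoning
  i = indicator (p x ∧ q x)
  j = indicator (p x ∧ not (q x))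
  c = count (λ x → p x ∧ q x) xs
  d = count (λ x → p x ∧ not (q x)) xs
  split : ∀ a b → indicator a ≡ indicator (a ∧ b) + indicator (a ∧ not b)
  split false b = refl
  split true false = refl
  split true true = refl
  +-interchange : ∀ i j c d → (i + j) + (c + d) ≡ (i + c) + (j + d)
  +-interchange = solve-∀

count-++ : ∀ (p : V → Bool) xs ys → count p (xs ++ ys) ≡ count p xs + count p ys
count-++ p [] ys = refl
count-++ p (x ∷ xs) ys = trans (cong (indicator (p x) +_) (count-++ p xs ys)) (sym (+-assoc (indicator (p x)) _ _))

count-map : ∀ (p : B → Bool) (f : A → B) xs → count p (map f xs) ≡ count (p ∘ f) xs
count-map p f [] = refl
count-map p f (x ∷ xs) = cong (indicator (p (f x)) +_) (count-map p f xs)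

length≤sum-count : ∀ {n} (P : Fin n → V → Bool) xs → (∀ x → x ∈ xs → ∃[ i ] P i x ≡ true) →
                   length xs ≤ sum (λ i → count (P i) xs)
length≤sum-count P [] h = z≤n
length≤sum-count P (x ∷ xs) h with i , Pix ← h x (here refl) = begin
  1 + length xs                                              ≤⟨ +-mono-≤ 1≤ (length≤sum-count P xs (λ y → h y ∘ there)) ⟩
  sum (λ i → indicator (P i x)) + sum (λ i → count (P i) xs) ≡⟨ ∑-distrib-+ (λ i → indicator (P i x)) (λ i → count (P i) xs) ⟨
  sum (λ i → count (P i) (x ∷ xs))                           ∎
  where
  open ≤-Reasoning
  1≤ : 1 ≤ sum (λ i → indicator (P i x))
  1≤ = ≤-trans (≤-reflexive (cong indicator (sym Pix))) (term≤sum (λ i → indicator (P i x)) i)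

module _ (_≟_ : DecidableEquality A) where

  count-remove : ∀ (p : A → Bool) a {xs} → Unique xs → count p xs ≤ suc (count (λ x → p x ∧ not ⌊ x ≟ a ⌋) xs)
  count-remove p a [] = z≤n
  count-remove p a {x ∷ xs} (x∉ ∷ u) with p x | x ≟ a
  ... | false | _ = count-remove p a u
  ... | true | no _ = s≤s (count-remove p a u)
  ... | true | yes refl = s≤s (count-mono∈ xs keep)
    where
    keep : ∀ y → y ∈ xs → p y ≡ true → p y ∧ not ⌊ y ≟ x ⌋ ≡ true
    keep y y∈ py with y ≟ x
    ... | yes refl = contradiction refl (All.lookup x∉ y∈)
    ... | no _ rewrite py = refl

  -- Each `u` satisfying `Q` accounts for the single value `g u`: the induction on `us` strikes that
  -- value from `p`, which lowers the count by at most one because `xs` has no repetitions.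
  count-cover : ∀ (g : B → A) (p : A → Bool) (Q : B → Bool) {xs} us → Unique xs →
                (∀ x → x ∈ xs → p x ≡ true → ∃[ u ] (u ∈ us × g u ≡ x × Q u ≡ true)) →
                count p xs ≤ count Q us
  count-cover g p Q {xs} [] uq h = begin
    count p xs             ≤⟨ count-mono∈ xs (λ x x∈ px → ⊥-elim (absurd (h x x∈ px))) ⟩
    count (λ _ → false) xs ≡⟨ none xs ⟩
    0 ∎
    where
    open ≤-Reasoning
    absurd : ∀ {x} → ∃[ u ] (u ∈ [] × g u ≡ x × Q u ≡ true) → ⊥
    absurd ()
    none : ∀ {A : Set} (xs : List A) → count (λ _ → false) xs ≡ 0
    none [] = refl
    none (_ ∷ xs) = none xs
  count-cover g p Q {xs} (u ∷ us) uq h with Q u in Qu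
  ... | false = count-cover g p Q us uq h′
    where
    h′ : ∀ x → x ∈ xs → p x ≡ true → ∃[ u ] (u ∈ us × g u ≡ x × Q u ≡ true)
    h′ x x∈ px with h x x∈ px
    ... | v , here refl , _ , Qv = contradiction (trans (sym Qu) Qv) λ ()
    ... | v , there v∈ , e , Qv = v , v∈ , e , Qv
  ... | true = ≤-trans (count-remove p (g u) uq) (s≤s (count-cover g _ Q us uq h′))
    where
    h′ : ∀ x → x ∈ xs → p x ∧ not ⌊ x ≟ g u ⌋ ≡ true → ∃[ u ] (u ∈ us × g u ≡ x × Q u ≡ true)
    h′ x x∈ px with h x x∈ (∧-conicalˡ _ _ px)
    h′ x x∈ px | v , there v∈ , e , Qv = v , v∈ , e , Qv
    h′ x x∈ px | v , here refl , e , Qv with x ≟ g u | ∧-conicalʳ (p x) _ px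
    ... | no x≢ | _ = contradiction (sym e) x≢
    ... | yes _ | ()

-- K doubles at each predicate examined: the hypothesis of common is split between the
-- points satisfying the predicate and the others, and one of the two keeps half the excess.
density : ℕ → ℕ → ℕ
density zero K = K
density (suc M) K = K * (2 + M) + density M (2 * K)

K*[1+M]≤density : ∀ M K → K * suc M ≤ density M K
K*[1+M]≤density zero K = ≤-reflexive (*-identityʳ K)
K*[1+M]≤density (suc M) K = m≤m+n _ _

-- The hypothesis says that a point of A satisfies more than c − 1 of the P i on average;
-- count A us is added on the right so that the truncated c ∸ 1 does not occur.
common : ∀ M c K (P : Fin M → V → Bool) (us : List V) (A : V → Bool) N → 0 < N →
  N + K * (c * count A us) ≤ K * (sum (λ i → count (λ u → A u ∧ P i u) us) + count A us) →
  Σ (Fin c → Fin M) λ σ → Injective _≡_ _≡_ σ × Σ (V → Bool) λ B →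
    (∀ u → B u ≡ true → A u ≡ true × (∀ j → P (σ j) u ≡ true)) × N ≤ density M K * count B us
-- No index remains to be found, so `A` itself serves; every term of the sum is at most
-- `count A us`, whence N ≤ K (M + 1) `count A us`.
common M zero K P us A N 0<N h =
  (λ ()) , (λ {}) , A , (λ u Au → Au , λ ()) , (begin
    N                                                          ≤⟨ m≤m+n N _ ⟩
    N + K * 0                                                  ≤⟨ h ⟩
    K * (sum (λ i → count (λ u → A u ∧ P i u) us) + a)         ≤⟨ *-monoʳ-≤ K (+-monoˡ-≤ a (sum-mono {M} (λ i → count-mono us (λ u → ∧-conicalˡ (A u) (P i u))))) ⟩
    K * (sum {M} (λ _ → a) + a)                                ≡⟨ cong (λ z → K * (z + a)) (sum-const M a) ⟩
    K * (M * a + a)                                            ≡⟨ regroup K M a ⟩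
    K * suc M * a                                              ≤⟨ *-monoˡ-≤ a (K*[1+M]≤density M K) ⟩
    density M K * a                                            ∎)
  where
  open ≤-Reasoning
  a = count A us
  regroup : ∀ K M a → K * (M * a + a) ≡ K * suc M * a
  regroup = solve-∀
-- With no predicate left the sum is empty, and the hypothesis would force N = 0.
common zero (suc c) K P us A N 0<N h =
  contradiction (+-cancelʳ-≤ (K * count A us) N 0 (≤-trans (+-monoʳ-≤ N (*-monoʳ-≤ K (m≤m+n _ _))) h)) (<⇒≱ 0<N)
common {V = V} (suc M) (suc c) K P us A N 0<N h = result
  where
  open ≤-Reasoning
  Aᵗ Aᶠ : V → Bool
  Aᵗ u = A u ∧ P zero u
  Aᶠ u = A u ∧ not (P zero u)
  at = count Aᵗ us
  af = count Aᶠ us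
  S St Sf : ℕ
  S = sum (λ i → count (λ u → A u ∧ P (suc i) u) us)
  St = sum (λ i → count (λ u → Aᵗ u ∧ P (suc i) u) us)
  Sf = sum (λ i → count (λ u → Aᶠ u ∧ P (suc i) u) us)

  a≡ : count A us ≡ at + af
  a≡ = count-split A (P zero) us
  S≤ : S ≤ St + Sf
  S≤ = begin
    S  ≤⟨ sum-mono (λ i → ≤-trans (≤-reflexive (count-split _ (P zero) us))
            (+-mono-≤ (count-mono us (λ u → ∧-shuffle (A u) (P (suc i) u) (P zero u)))
                      (count-mono us (λ u → ∧-shuffle (A u) (P (suc i) u) (not (P zero u)))))) ⟩
    sum (λ i → count (λ u → Aᵗ u ∧ P (suc i) u) us + count (λ u → Aᶠ u ∧ P (suc i) u) us)
       ≡⟨ ∑-distrib-+ (λ i → count (λ u → Aᵗ u ∧ P (suc i) u) us) (λ i → count (λ u → Aᶠ u ∧ P (suc i) u) us) ⟩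
    St + Sf ∎
    where
    ∧-shuffle : ∀ a b c → (a ∧ b) ∧ c ≡ true → (a ∧ c) ∧ b ≡ true
    ∧-shuffle true true true _ = refl

  h′ : N + K * (suc c * (at + af)) ≤ K * ((at + (St + Sf)) + (at + af))
  h′ = begin
    N + K * (suc c * (at + af))            ≡⟨ cong (λ z → N + K * (suc c * z)) a≡ ⟨
    N + K * (suc c * count A us)           ≤⟨ h ⟩
    K * ((at + S) + count A us)            ≤⟨ *-monoʳ-≤ K (+-mono-≤ (+-monoʳ-≤ at S≤) (≤-reflexive a≡)) ⟩
    K * ((at + (St + Sf)) + (at + af))     ∎

  weaken : ∀ x → N ≤ density M (2 * K) * x → N ≤ density (suc M) K * x
  weaken x le = ≤-trans le (*-monoˡ-≤ x (m≤n+m (density M (2 * K)) (K * (2 + M))))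

  -- If the hypothesis with 2K fails on the points outside `P zero`, subtracting this failure from
  -- twice `h′` yields it on the points inside, with one index fewer to find.
  take : ¬ (N + 2 * K * (suc c * af) ≤ 2 * K * (Sf + af)) → N + 2 * K * (c * at) ≤ 2 * K * (St + at)
  take ¬skip = +-cancelʳ-≤ (N + 2 * K * (suc c * af) + 2 * K * at) _ _ (begin
    (N + 2 * K * (c * at)) + (N + 2 * K * (suc c * af) + 2 * K * at)   ≡⟨ e₁ N K c at af ⟩
    2 * (N + K * (suc c * (at + af)))                                  ≤⟨ *-monoʳ-≤ 2 h′ ⟩
    2 * (K * ((at + (St + Sf)) + (at + af)))                           ≡⟨ e₂ K at af St Sf ⟩
    (2 * K * (St + at) + 2 * K * at) + 2 * K * (Sf + af)               ≤⟨ +-monoʳ-≤ (2 * K * (St + at) + 2 * K * at) (<⇒≤ (≰⇒> ¬skip)) ⟩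
    (2 * K * (St + at) + 2 * K * at) + (N + 2 * K * (suc c * af))      ≡⟨ e₃ (2 * K * (St + at)) (2 * K * at) (N + 2 * K * (suc c * af)) ⟩
    2 * K * (St + at) + (N + 2 * K * (suc c * af) + 2 * K * at)        ∎)
    where
    e₁ : ∀ N K c at af → (N + 2 * K * (c * at)) + (N + 2 * K * (suc c * af) + 2 * K * at) ≡ 2 * (N + K * (suc c * (at + af)))
    e₁ = solve-∀
    e₂ : ∀ K at af St Sf → 2 * (K * ((at + (St + Sf)) + (at + af))) ≡ (2 * K * (St + at) + 2 * K * at) + 2 * K * (Sf + af)
    e₂ = solve-∀
    e₃ : ∀ x y z → (x + y) + z ≡ x + (z + y)
    e₃ = solve-∀

  result : Σ (Fin (suc c) → Fin (suc M)) λ σ → Injective _≡_ _≡_ σ × Σ (V → Bool) λ B →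
    (∀ u → B u ≡ true → A u ≡ true × (∀ j → P (σ j) u ≡ true)) × N ≤ density (suc M) K * count B us
  result with N + 2 * K * (suc c * af) ≤? 2 * K * (Sf + af)
  ... | yes skip with σ , σ-inj , B , B-ok , N≤ ← common M (suc c) (2 * K) (P ∘ suc) us Aᶠ N 0<N skip =
    suc ∘ σ , σ-inj ∘ sucF-injective , B ,
    (λ u Bu → ∧-conicalˡ _ _ (proj₁ (B-ok u Bu)) , proj₂ (B-ok u Bu)) , weaken _ N≤
  ... | no ¬skip with σ , σ-inj , B , B-ok , N≤ ← common M c (2 * K) (P ∘ suc) us Aᵗ N 0<N (take ¬skip) =
    lift 1 σ , lift-injective σ σ-inj 1 , B , B-ok′ , weaken _ N≤
    where
    B-ok′ : ∀ u → B u ≡ true → A u ≡ true × (∀ j → P (lift 1 σ j) u ≡ true)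
    B-ok′ u Bu = ∧-conicalˡ _ _ Au , λ where
        zero → ∧-conicalʳ (A u) _ Au
        (suc j) → proj₂ (B-ok u Bu) j
      where Au = proj₁ (B-ok u Bu)

-- Averaging by a scan: a selected value uses up at most `b` of the sum and a skipped one at most
-- `h`, so the sum cannot run out before `M` indices are selected.
select-large : ∀ {n} M (f : Fin n → ℕ) b h → 0 < b → (∀ i → f i ≤ b) → M * b + n * h ≤ sum f →
  Σ (Fin M → Fin n) λ σ → Injective _≡_ _≡_ σ × (∀ j → h ≤ f (σ j))
select-large zero f b h 0<b f≤b le = (λ ()) , (λ {}) , λ ()
select-large {zero} (suc M) f b h 0<b f≤b le =
  contradiction (≤-trans (≤-trans (m≤m+n b _) (m≤m+n (b + M * b) _)) le) (<⇒≱ 0<b)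
select-large {suc n} (suc M) f b h 0<b f≤b le = result
  where
  open ≤-Reasoning
  move : ∀ x y z → x + (y + z) ≡ y + (x + z)
  move = solve-∀
  take-rest : M * b + n * h ≤ sum (f ∘ suc)
  take-rest = +-cancelˡ-≤ b _ _ (begin
    b + (M * b + n * h)          ≤⟨ +-monoʳ-≤ b (+-monoʳ-≤ (M * b) (m≤n+m (n * h) h)) ⟩
    b + (M * b + suc n * h)      ≡⟨ +-assoc b _ _ ⟨
    suc M * b + suc n * h        ≤⟨ le ⟩
    f zero + sum (f ∘ suc)       ≤⟨ +-monoˡ-≤ _ (f≤b zero) ⟩
    b + sum (f ∘ suc)            ∎)
  skip-rest : f zero ≤ h → suc M * b + n * h ≤ sum (f ∘ suc)
  skip-rest f₀≤h = +-cancelˡ-≤ h _ _ (begin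
    h + (suc M * b + n * h)      ≡⟨ move h (suc M * b) (n * h) ⟩
    suc M * b + suc n * h        ≤⟨ le ⟩
    f zero + sum (f ∘ suc)       ≤⟨ +-monoˡ-≤ _ f₀≤h ⟩
    h + sum (f ∘ suc)            ∎)
  result : Σ (Fin (suc M) → Fin (suc n)) λ σ → Injective _≡_ _≡_ σ × (∀ j → h ≤ f (σ j))
  result with h ≤? f zero
  ... | yes h≤ with σ , σ-inj , large ← select-large M (f ∘ suc) b h 0<b (f≤b ∘ suc) take-rest =
    lift 1 σ , lift-injective σ σ-inj 1 , λ where
      zero → h≤
      (suc j) → large j
  ... | no h≰ with σ , σ-inj , large ← select-large (suc M) (f ∘ suc) b h 0<b (f≤b ∘ suc) (skip-rest (<⇒≤ (≰⇒> h≰))) =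
    suc ∘ σ , σ-inj ∘ sucF-injective , large

-- Grids in dense sets of tuples

tuples : ∀ n q → List (Vec (Fin n) q)
tuples n zero = [] ∷ []
tuples n (suc q) = concat (Data.List.tabulate (λ y → map (y ∷_) (tuples n q)))

count-concat : ∀ {n} (p : V → Bool) (f : Fin n → List V) → count p (concat (Data.List.tabulate f)) ≡ sum (λ i → count p (f i))
count-concat {n = zero} p f = refl
count-concat {n = suc n} p f = trans (count-++ p (f zero) _) (cong (count p (f zero) +_) (count-concat p (f ∘ suc)))

count-tuples : ∀ n q (A : Vec (Fin n) (suc q) → Bool) →
  count A (tuples n (suc q)) ≡ sum (λ y → count (A ∘ (y ∷_)) (tuples n q))
count-tuples n q A = trans (count-concat A (λ y → map (y ∷_) (tuples n q)))
  (sum-cong-≗ (λ y → count-map A (y ∷_) (tuples n q)))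

length-tuples : ∀ n q → length (tuples n q) ≡ n ^ q
length-tuples n zero = refl
length-tuples n (suc q) = begin
  length (tuples n (suc q))                          ≡⟨ count-true (tuples n (suc q)) ⟨
  count (λ _ → true) (tuples n (suc q))              ≡⟨ count-tuples n q (λ _ → true) ⟩
  sum {n} (λ y → count (λ _ → true) (tuples n q))    ≡⟨ sum-const n _ ⟩
  n * count (λ _ → true) (tuples n q)                ≡⟨ cong (n *_) (trans (count-true (tuples n q)) (length-tuples n q)) ⟩
  n * n ^ q                                          ∎
  where open ≡-Reasoning

∈-tuples : ∀ {n q} (x : Vec (Fin n) q) → x ∈ tuples n q
∈-tuples [] = here refl
∈-tuples {n} {suc q} (y ∷ x) = at (λ y → map (y ∷_) (tuples n q)) y (∈-map⁺ (y ∷_) (∈-tuples x))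
  where
  at : ∀ {m} {V : Set} {v : V} (f : Fin m → List V) i → v ∈ f i → v ∈ concat (Data.List.tabulate f)
  at f zero = ∈-++⁺ˡ
  at f (suc i) v∈ = ∈-++⁺ʳ (f zero) (at (f ∘ suc) i v∈)

count≤length : ∀ (p : V → Bool) xs → count p xs ≤ length xs
count≤length p xs = ≤-trans (count-mono xs (λ _ _ → refl)) (≤-reflexive (count-true xs))

positive-factor : ∀ a b → 0 < a * b → 0 < a
positive-factor (suc a) b _ = s≤s z≤n

-- The parts belong to ordered coordinates and may overlap; they become disjoint later, when `A`
-- consists of tuples with distinct entries.
Grid : ∀ {n q} → ℕ → (Vec (Fin n) q → Bool) → Set
Grid {n} {q} t A = Σ (Fin q → Fin t → Fin n) λ X → (∀ i → Injective _≡_ _≡_ (X i)) ×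
  (∀ (g : Fin q → Fin t) → A (tabulate (λ i → X i (g i))) ≡ true)

DenseHasGrid : (n q t K : ℕ) → Set
DenseHasGrid n q t K = (A : Vec (Fin n) q → Bool) → n ^ q ≤ K * count A (tuples n q) → Grid t A

-- Erdős' theorem by induction on `q`: many first coordinates have dense fibres, `t` of these fibres
-- have a dense intersection by `common`, and a grid in the intersection extends by those `t`
-- coordinates.
dense⇒grid : ∀ q t K → ∃[ N ] (∀ n → N ≤ n → DenseHasGrid n q t K)
dense⇒grid zero t K = 0 , λ n _ A h → (λ ()) , (λ ()) , λ g → nonempty A h
  where
  nonempty : ∀ {n} (A : Vec (Fin n) 0 → Bool) → 1 ≤ K * count A (tuples n 0) → A [] ≡ true
  nonempty A h with A []
  ... | true = refl
  ... | false = contradiction (≤-trans h (≤-reflexive (*-zeroʳ K))) λ ()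
dense⇒grid (suc q) t K = N , step
  where
  -- Each selected fibre has at least n^q / (2K) points, so 2K times the total size of `M` fibres is
  -- at least M n^q = n^q + 2 K t n^q, which is the excess n^q that `common` asks for.
  M = suc (2 * K * t)
  rec = dense⇒grid q t (density M (2 * K))
  -- The first bound makes `M` full fibres cost at most n^(q+1) in `select-large`; the second serves
  -- the induction.
  N = suc (M * (2 * K)) ⊔ proj₁ rec
  step : ∀ n → N ≤ n → DenseHasGrid n (suc q) t K
  step n N≤n A h = X , X-inj , X-ok
    where
    open ≤-Reasoning
    us = tuples n q
    a : Fin n → ℕ
    a y = count (A ∘ (y ∷_)) us
    2KM<n : suc (M * (2 * K)) ≤ n
    2KM<n = ≤-trans (m≤m⊔n _ (proj₁ rec)) N≤n
    instance
      n≢0 : NonZero n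
      n≢0 = >-nonZero (≤-trans (s≤s z≤n) 2KM<n)
    a≤ : ∀ y → a y ≤ n ^ q
    a≤ y = ≤-trans (count≤length (A ∘ (y ∷_)) us) (≤-reflexive (length-tuples n q))
    0<n^q : 0 < n ^ q
    0<n^q = m^n>0 n q
    K≢0 : 0 < K
    K≢0 = positive-factor K _ (≤-trans (m^n>0 n (suc q)) h)
    bound : 0 < 2 * K * n ^ q
    bound = *-mono-≤ {1} {_} {1} (≤-trans K≢0 (m≤m+n K _)) 0<n^q
    total : M * (2 * K * n ^ q) + n * n ^ q ≤ sum (λ y → 2 * K * a y)
    total = begin
      M * (2 * K * n ^ q) + n * n ^ q   ≡⟨ cong (_+ n * n ^ q) (*-assoc M (2 * K) (n ^ q)) ⟨
      M * (2 * K) * n ^ q + n * n ^ q   ≤⟨ +-monoˡ-≤ (n * n ^ q) (*-monoˡ-≤ (n ^ q) (≤-trans (n≤1+n _) 2KM<n)) ⟩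
      n * n ^ q + n * n ^ q             ≡⟨ cong (n * n ^ q +_) (+-identityʳ _) ⟨
      2 * (n * n ^ q)                   ≤⟨ *-monoʳ-≤ 2 h ⟩
      2 * (K * count A (tuples n (suc q))) ≡⟨ *-assoc 2 K _ ⟨
      2 * K * count A (tuples n (suc q))   ≡⟨ cong (2 * K *_) (count-tuples n q A) ⟩
      2 * K * sum a                     ≡⟨ *-distribˡ-sum (2 * K) a ⟩
      sum (λ y → 2 * K * a y)           ∎
    selected = select-large M (λ y → 2 * K * a y) (2 * K * n ^ q) (n ^ q) bound (λ y → *-monoʳ-≤ (2 * K) (a≤ y)) total
    σ = proj₁ selected
    dense : n ^ q + 2 * K * (t * count (λ _ → true) us) ≤
            2 * K * (sum (λ i → count (λ u → true ∧ A (σ i ∷ u)) us) + count (λ _ → true) us)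
    dense = begin
      n ^ q + 2 * K * (t * count (λ _ → true) us)  ≡⟨ cong (λ z → n ^ q + 2 * K * (t * z)) (trans (count-true us) (length-tuples n q)) ⟩
      n ^ q + 2 * K * (t * n ^ q)                  ≡⟨ cong (n ^ q +_) (*-assoc (2 * K) t _) ⟨
      M * n ^ q                                    ≡⟨ sum-const M (n ^ q) ⟨
      sum {M} (λ _ → n ^ q)                        ≤⟨ sum-mono (proj₂ (proj₂ selected)) ⟩
      sum (λ i → 2 * K * a (σ i))                  ≡⟨ *-distribˡ-sum (2 * K) (a ∘ σ) ⟨
      2 * K * sum (a ∘ σ)                          ≤⟨ *-monoʳ-≤ (2 * K) (m≤m+n _ _) ⟩
      2 * K * (sum (a ∘ σ) + count (λ _ → true) us) ∎
    link = common M t (2 * K) (λ i u → A (σ i ∷ u)) us (λ _ → true) (n ^ q) 0<n^q dense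
    τ = proj₁ link
    L = proj₁ (proj₂ (proj₂ link))
    L-ok = proj₁ (proj₂ (proj₂ (proj₂ link)))
    tail = proj₂ rec n (≤-trans (m≤n⊔m (suc (M * (2 * K))) _) N≤n) L (proj₂ (proj₂ (proj₂ (proj₂ link))))
    X : Fin (suc q) → Fin t → Fin n
    X zero j = σ (τ j)
    X (suc i) j = proj₁ tail i j
    X-inj : ∀ i → Injective _≡_ _≡_ (X i)
    X-inj zero e = proj₁ (proj₂ link) (proj₁ (proj₂ selected) e)
    X-inj (suc i) = proj₁ (proj₂ tail) i
    X-ok : ∀ (g : Fin (suc q) → Fin t) → A (tabulate (λ i → X i (g i))) ≡ true
    X-ok g = proj₂ (L-ok _ (proj₂ (proj₂ tail) (g ∘ suc))) (g zero)

-- Subsets of Fin n as boolean vectors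

private variable
  n p q r : ℕ
  S T : Subset n

isYes⁺ : ∀ {P : Set} (d : Dec P) → P → ⌊ d ⌋ ≡ true
isYes⁺ (yes _) _ = refl
isYes⁺ (no ¬p) p = contradiction p ¬p

isYes⁻ : ∀ {P : Set} (d : Dec P) → ⌊ d ⌋ ≡ true → P
isYes⁻ (yes p) _ = p

∨⁻ : ∀ a {b} → a ∨ b ≡ true → a ≡ true ⊎ b ≡ true
∨⁻ true _ = inj₁ refl
∨⁻ false e = inj₂ e

infix 4 _∈ₛ_
_∈ₛ_ : Fin n → Subset n → Set
x ∈ₛ S = lookup S x ≡ true

_≟ₛ_ : DecidableEquality (Subset n)
_≟ₛ_ = ≡-dec _≟B_

_∈ₗ?_ : (S : Subset n) (Es : List (Subset n)) → Dec (S ∈ Es)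
S ∈ₗ? Es = any? (S ≟ₛ_) Es

subset-ext : (∀ y → y ∈ₛ S → y ∈ₛ T) → (∀ y → y ∈ₛ T → y ∈ₛ S) → S ≡ T
subset-ext {S = S} {T} f g = begin
  S                    ≡⟨ tabulate∘lookup S ⟨
  tabulate (lookup S)  ≡⟨ tabulate-cong (λ y → ⇔→≡ (mk⇔ (f y) (g y))) ⟩
  tabulate (lookup T)  ≡⟨ tabulate∘lookup T ⟩
  T                    ∎
  where open ≡-Reasoning

∈-tabulate⁺ : ∀ (f : Fin n → Bool) y → f y ≡ true → y ∈ₛ tabulate f
∈-tabulate⁺ f y = trans (lookup∘tabulate f y)

∈-tabulate⁻ : ∀ (f : Fin n → Bool) y → y ∈ₛ tabulate f → f y ≡ true
∈-tabulate⁻ f y = trans (sym (lookup∘tabulate f y))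

anyF⁺ : (f : Fin p → Bool) → ∀ x → f x ≡ true → anyF f ≡ true
anyF⁺ f zero fx rewrite fx = refl
anyF⁺ f (suc x) fx = trans (cong (f zero ∨_) (anyF⁺ (f ∘ suc) x fx)) (∨-zeroʳ (f zero))

anyF⁻ : (f : Fin p → Bool) → anyF f ≡ true → ∃[ x ] f x ≡ true
anyF⁻ {suc p} f e with ∨⁻ (f zero) e
... | inj₁ f0 = zero , f0
... | inj₂ e′ with x , fx ← anyF⁻ (f ∘ suc) e′ = suc x , fx

∈-image⁺ : (φ : Fin p → Fin n) (S : Subset p) → ∀ x {y} → x ∈ₛ S → φ x ≡ y → y ∈ₛ image φ S
∈-image⁺ φ S x {y} x∈ e = ∈-tabulate⁺ (λ y → anyF (λ x → lookup S x ∧ ⌊ φ x ≟F y ⌋)) y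
  (anyF⁺ (λ x → lookup S x ∧ ⌊ φ x ≟F y ⌋) x (cong₂ _∧_ x∈ (isYes⁺ (φ x ≟F y) e)))

∈-image⁻ : (φ : Fin p → Fin n) (S : Subset p) → ∀ {y} → y ∈ₛ image φ S → ∃[ x ] (x ∈ₛ S × φ x ≡ y)
∈-image⁻ φ S {y} y∈
  with x , e ← anyF⁻ (λ x → lookup S x ∧ ⌊ φ x ≟F y ⌋) (∈-tabulate⁻ (λ y → anyF (λ x → lookup S x ∧ ⌊ φ x ≟F y ⌋)) y y∈) =
  x , ∧-conicalˡ _ _ e , isYes⁻ (φ x ≟F y) (∧-conicalʳ _ _ e)

support : Vec (Fin n) q → Subset n
support x = tabulate (λ y → anyF (λ i → ⌊ lookup x i ≟F y ⌋))

∈-support⁺ : ∀ (x : Vec (Fin n) q) {y} i → lookup x i ≡ y → y ∈ₛ support x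
∈-support⁺ x {y} i e = ∈-tabulate⁺ (λ y → anyF (λ i → ⌊ lookup x i ≟F y ⌋)) y
  (anyF⁺ (λ i → ⌊ lookup x i ≟F y ⌋) i (isYes⁺ (lookup x i ≟F y) e))

∈-support⁻ : ∀ (x : Vec (Fin n) q) {y} → y ∈ₛ support x → ∃[ i ] lookup x i ≡ y
∈-support⁻ x {y} y∈
  with i , e ← anyF⁻ (λ i → ⌊ lookup x i ≟F y ⌋) (∈-tabulate⁻ (λ y → anyF (λ i → ⌊ lookup x i ≟F y ⌋)) y y∈) =
  i , isYes⁻ (lookup x i ≟F y) e

∈-insert⁻ : ∀ (S : Subset n) z {y} → y ∈ₛ S [ z ]≔ true → y ≡ z ⊎ y ∈ₛ S
∈-insert⁻ S z {y} y∈ with y ≟F z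
... | yes e = inj₁ e
... | no y≢z = inj₂ (trans (sym (lookup∘update′ y≢z S true)) y∈)

∈-insert⁺ : ∀ (S : Subset n) z {y} → y ≡ z ⊎ y ∈ₛ S → y ∈ₛ S [ z ]≔ true
∈-insert⁺ S z (inj₁ refl) = lookup∘update z S true
∈-insert⁺ S z {y} (inj₂ y∈) with y ≟F z
... | yes refl = lookup∘update z S true
... | no y≢z = trans (lookup∘update′ y≢z S true) y∈

enum : (S : Subset n) → Fin ∣ S ∣ → Fin n
enum (true ∷ S) zero = zero
enum (true ∷ S) (suc i) = suc (enum S i)
enum (false ∷ S) i = suc (enum S i)

enum-∈ : (S : Subset n) → ∀ i → enum S i ∈ₛ S
enum-∈ (true ∷ S) zero = refl
enum-∈ (true ∷ S) (suc i) = enum-∈ S i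
enum-∈ (false ∷ S) i = enum-∈ S i

enum-injective : (S : Subset n) → Injective _≡_ _≡_ (enum S)
enum-injective (true ∷ S) {zero} {zero} e = refl
enum-injective (true ∷ S) {suc i} {suc j} e = cong suc (enum-injective S (sucF-injective e))
enum-injective (false ∷ S) e = enum-injective S (sucF-injective e)

index : (S : Subset n) → ∀ {x} → x ∈ₛ S → Fin ∣ S ∣
index (true ∷ S) {zero} x∈ = zero
index (true ∷ S) {suc x} x∈ = suc (index S x∈)
index (false ∷ S) {suc x} x∈ = index S x∈

enum-index : (S : Subset n) → ∀ {x} (x∈ : x ∈ₛ S) → enum S (index S x∈) ≡ x
enum-index (true ∷ S) {zero} x∈ = refl
enum-index (true ∷ S) {suc x} x∈ = cong suc (enum-index S x∈)
enum-index (false ∷ S) {suc x} x∈ = cong suc (enum-index S x∈)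

index-injective : (S : Subset n) → ∀ {x y} (x∈ : x ∈ₛ S) (y∈ : y ∈ₛ S) → index S x∈ ≡ index S y∈ → x ≡ y
index-injective S x∈ y∈ e = trans (sym (enum-index S x∈)) (trans (cong (enum S) e) (enum-index S y∈))

∣delete∣ : (S : Subset n) → ∀ x → x ∈ₛ S → suc ∣ S [ x ]≔ false ∣ ≡ ∣ S ∣
∣delete∣ (true ∷ S) zero x∈ = refl
∣delete∣ (true ∷ S) (suc x) x∈ = cong suc (∣delete∣ S x x∈)
∣delete∣ (false ∷ S) (suc x) x∈ = ∣delete∣ S x x∈

subsetsOfSize : ∀ n → ℕ → List (Subset n)
subsetsOfSize zero zero = [] ∷ []
subsetsOfSize zero (suc q) = []
subsetsOfSize (suc n) zero = map (false ∷_) (subsetsOfSize n zero)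
subsetsOfSize (suc n) (suc q) = map (true ∷_) (subsetsOfSize n q) ++ map (false ∷_) (subsetsOfSize n (suc q))

∈-subsetsOfSize⁺ : (S : Subset n) → S ∈ subsetsOfSize n ∣ S ∣
∈-subsetsOfSize⁺ [] = here refl
∈-subsetsOfSize⁺ (true ∷ S) = ∈-++⁺ˡ (∈-map⁺ (true ∷_) (∈-subsetsOfSize⁺ S))
∈-subsetsOfSize⁺ {suc n} (false ∷ S) with ∣ S ∣ | ∈-subsetsOfSize⁺ S
... | zero | S∈ = ∈-map⁺ (false ∷_) S∈
... | suc q | S∈ = ∈-++⁺ʳ (map (true ∷_) (subsetsOfSize n q)) (∈-map⁺ (false ∷_) S∈)

∈-subsetsOfSize⁻ : ∀ n q {S} → S ∈ subsetsOfSize n q → ∣ S ∣ ≡ q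
∈-subsetsOfSize⁻ zero zero (here refl) = refl
∈-subsetsOfSize⁻ (suc n) zero S∈ with _ , T∈ , refl ← ∈-map⁻ (false ∷_) S∈ = ∈-subsetsOfSize⁻ n zero T∈
∈-subsetsOfSize⁻ (suc n) (suc q) S∈ with ∈-++⁻ (map (true ∷_) (subsetsOfSize n q)) S∈
... | inj₁ S∈ˡ with _ , T∈ , refl ← ∈-map⁻ (true ∷_) S∈ˡ = cong suc (∈-subsetsOfSize⁻ n q T∈)
... | inj₂ S∈ʳ with _ , T∈ , refl ← ∈-map⁻ (false ∷_) S∈ʳ = ∈-subsetsOfSize⁻ n (suc q) T∈

subsetsOfSize-unique : ∀ n q → Unique (subsetsOfSize n q)
subsetsOfSize-unique zero zero = All.[] ∷ []
subsetsOfSize-unique zero (suc q) = []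
subsetsOfSize-unique (suc n) zero = Unique.map⁺ ∷-injectiveʳ (subsetsOfSize-unique n zero)
subsetsOfSize-unique (suc n) (suc q) = Unique.++⁺
  (Unique.map⁺ ∷-injectiveʳ (subsetsOfSize-unique n q))
  (Unique.map⁺ ∷-injectiveʳ (subsetsOfSize-unique n (suc q)))
  λ (S∈ˡ , S∈ʳ) → heads-differ (∈-map⁻ (true ∷_) S∈ˡ) (∈-map⁻ (false ∷_) S∈ʳ)
  where
  heads-differ : ∀ {S : Subset (suc n)} {xs ys : List (Subset n)} →
    ∃[ T ] (T ∈ xs × S ≡ true ∷ T) → ∃[ T ] (T ∈ ys × S ≡ false ∷ T) → ⊥
  heads-differ (_ , _ , refl) (_ , _ , ())

length-subsetsOfSize : ∀ n q → length (subsetsOfSize n q) ≡ n C q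
length-subsetsOfSize zero zero = refl
length-subsetsOfSize zero (suc q) = refl
length-subsetsOfSize (suc n) zero = trans (length-map (false ∷_) (subsetsOfSize n zero)) (length-subsetsOfSize n zero)
length-subsetsOfSize (suc n) (suc q) = begin
  length (map (true ∷_) (subsetsOfSize n q) ++ map (false ∷_) (subsetsOfSize n (suc q)))
    ≡⟨ length-++ (map (true ∷_) (subsetsOfSize n q)) ⟩
  length (map (true ∷_) (subsetsOfSize n q)) + length (map (false ∷_) (subsetsOfSize n (suc q)))
    ≡⟨ cong₂ _+_ (trans (length-map _ (subsetsOfSize n q)) (length-subsetsOfSize n q))
                 (trans (length-map _ (subsetsOfSize n (suc q))) (length-subsetsOfSize n (suc q))) ⟩
  (n C q) + (n C suc q)  ≡⟨ nCk+nC[k+1]≡[n+1]C[k+1] n q ⟩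
  suc n C suc q          ∎
  where open ≡-Reasoning

-- Matchings and covers

PairwiseDisjoint : ∀ {j} → (Fin j → Subset n) → Set
PairwiseDisjoint D = ∀ i i′ {x} → x ∈ₛ D i → x ∈ₛ D i′ → i ≡ i′

enumAs : (S : Subset n) → ∣ S ∣ ≡ r → Fin r → Fin n
enumAs S refl = enum S

enumAs-∈ : (S : Subset n) (e : ∣ S ∣ ≡ r) → ∀ i → enumAs S e i ∈ₛ S
enumAs-∈ S refl = enum-∈ S

enumAs-injective : (S : Subset n) (e : ∣ S ∣ ≡ r) → Injective _≡_ _≡_ (enumAs S e)
enumAs-injective S refl = enum-injective S

enumAs-surjective : (S : Subset n) (e : ∣ S ∣ ≡ r) → ∀ {x} → x ∈ₛ S → ∃[ i ] enumAs S e i ≡ x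
enumAs-surjective S refl x∈ = index S x∈ , enum-index S x∈

-- Numbers the union of the sets by `Fin (j * r)` in blocks, as in `matching`. The map `vertex`
-- serves both as the embedding of a matching and, for a maximal packing, as a cover.
module Packing {j} (D : Fin j → Subset n) (size : ∀ i → ∣ D i ∣ ≡ r) (disjoint : PairwiseDisjoint D) where

  at : Fin j × Fin r → Fin n
  at (i , k) = enumAs (D i) (size i) k

  at-∈ : ∀ a → at a ∈ₛ D (proj₁ a)
  at-∈ (i , k) = enumAs-∈ (D i) (size i) k

  vertex : Fin (j * r) → Fin n
  vertex y = at (remQuot r y)

  vertex-combine : ∀ i k → vertex (combine i k) ≡ enumAs (D i) (size i) k
  vertex-combine i k = cong at (remQuot-combine i k)

  vertex-injective : Injective _≡_ _≡_ vertex
  vertex-injective {y} {y′} e = begin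
    y                                         ≡⟨ combine-remQuot {j} r y ⟨
    uncurry (combine {j}) (remQuot {j} r y)   ≡⟨ cong (uncurry (combine {j})) (same (remQuot r y) (remQuot r y′) e) ⟩
    uncurry (combine {j}) (remQuot {j} r y′)  ≡⟨ combine-remQuot {j} r y′ ⟩
    y′ ∎
    where
    open ≡-Reasoning
    same : ∀ a b → at a ≡ at b → a ≡ b
    same (i , k) (i′ , k′) e with disjoint i i′ (at-∈ (i , k)) (subst (_∈ₛ D i′) (sym e) (at-∈ (i′ , k′)))
    ... | refl = cong (i ,_) (enumAs-injective (D i) (size i) e)

  block : Fin j → Fin (j * r) → Bool
  block i y = ⌊ proj₁ (remQuot r y) ≟F i ⌋

  image-matching : ∀ i → image vertex (pedge (matching j r) i) ≡ D i
  image-matching i = subset-ext forth back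
    where
    forth : ∀ y → y ∈ₛ image vertex (pedge (matching j r) i) → y ∈ₛ D i
    forth y y∈ with x , x∈ , refl ← ∈-image⁻ vertex (pedge (matching j r) i) y∈ =
      subst (λ i → vertex x ∈ₛ D i) (isYes⁻ (proj₁ (remQuot r x) ≟F i) (∈-tabulate⁻ (block i) x x∈)) (at-∈ (remQuot r x))
    back : ∀ y → y ∈ₛ D i → y ∈ₛ image vertex (pedge (matching j r) i)
    back y y∈ with k , e ← enumAs-surjective (D i) (size i) y∈ =
      ∈-image⁺ vertex (pedge (matching j r) i) (combine i k)
        (∈-tabulate⁺ (block i) (combine i k) (isYes⁺ (proj₁ (remQuot r (combine i k)) ≟F i) (cong proj₁ (remQuot-combine i k))))
        (trans (vertex-combine i k) e)

contains-matching : (H : RGraph r n) → ∀ {j} (D : Fin j → Subset n) → (∀ i → D i ∈ edges H) → PairwiseDisjoint D →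
                    Contains H (matching j r)
contains-matching H D D∈ disjoint = vertex , vertex-injective , λ i → subst (_∈ edges H) (sym (image-matching i)) (D∈ i)
  where open Packing D (λ i → All.lookup (uniform H) (D∈ i)) disjoint

Covers : ∀ {j} → RGraph r n → (Fin j → Fin n) → Set
Covers H τ = ∀ E → E ∈ edges H → ∃[ i ] τ i ∈ₛ E

-- Greedy choice: a packing is extended by an edge that avoids all its vertices. If there is none,
-- those vertices meet every edge.
packing-or-cover : (H : RGraph r n) → ∀ j →
  (Σ (Fin j → Subset n) λ D → (∀ i → D i ∈ edges H) × PairwiseDisjoint D) ⊎
  (∃[ i ] (i < j × Σ (Fin (i * r) → Fin n) λ τ → Injective _≡_ _≡_ τ × Covers H τ))
packing-or-cover H zero = inj₁ ((λ ()) , (λ ()) , λ ())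
packing-or-cover {r} {n} H (suc j) with packing-or-cover H j
... | inj₂ (i , i<j , cover) = inj₂ (i , m≤n⇒m≤1+n i<j , cover)
... | inj₁ (D , D∈ , disjoint) = result
  where
  open Packing D (λ i → All.lookup (uniform H) (D∈ i)) disjoint
  avoids? : (E : Subset n) → Dec (∀ y → lookup E (vertex y) ≡ false)
  avoids? E = all? (λ y → lookup E (vertex y) ≟B false)
  result : (Σ (Fin (suc j) → Subset n) λ D → (∀ i → D i ∈ edges H) × PairwiseDisjoint D) ⊎
    (∃[ i ] (i < suc j × Σ (Fin (i * r) → Fin n) λ τ → Injective _≡_ _≡_ τ × Covers H τ))
  result with any? avoids? (edges H)
  ... | no ¬avoid = inj₂ (j , ≤-refl , vertex , vertex-injective , covers)
    where
    covers : Covers H vertex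
    covers E E∈ with y , ≢false ← ¬∀⟶∃¬ _ _ (λ y → lookup E (vertex y) ≟B false) (λ av → ¬avoid (lose E∈ av))
      with lookup E (vertex y) in eq
    ... | true = y , eq
    ... | false = contradiction refl ≢false
  ... | yes avoid with E , E∈ , E-avoids ← find avoid = inj₁ (D′ , D′∈ , disjoint′)
    where
    D′ : Fin (suc j) → Subset n
    D′ zero = E
    D′ (suc i) = D i
    D′∈ : ∀ i → D′ i ∈ edges H
    D′∈ zero = E∈
    D′∈ (suc i) = D∈ i
    clash : ∀ i {x} → x ∈ₛ E → x ∈ₛ D i → ⊥
    clash i x∈E x∈D with k , refl ← enumAs-surjective (D i) (All.lookup (uniform H) (D∈ i)) x∈D =
      contradiction (trans (sym x∈E) (trans (cong (lookup E) (sym (vertex-combine i k))) (E-avoids (combine i k)))) λ ()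
    disjoint′ : PairwiseDisjoint D′
    disjoint′ zero zero _ _ = refl
    disjoint′ zero (suc i′) x∈ x∈′ = ⊥-elim (clash i′ x∈ x∈′)
    disjoint′ (suc i) zero x∈ x∈′ = ⊥-elim (clash i x∈′ x∈)
    disjoint′ (suc i) (suc i′) x∈ x∈′ = cong suc (disjoint i i′ x∈ x∈′)

-- A copy of the complete (1+q)-partite hypergraph with one part z of size c and q parts X i of size t
record MultipartiteCopy (H : RGraph (suc q) n) (c t : ℕ) : Set where
  field
    z : Fin c → Fin n
    X : Fin q → Fin t → Fin n
    z-injective : Injective _≡_ _≡_ z
    X-injective : ∀ {i i′ a a′} → X i a ≡ X i′ a′ → i ≡ i′ × a ≡ a′
    z≢X : ∀ j i a → z j ≢ X i a
    transversal : ∀ j (g : Fin q → Fin t) → support (tabulate (λ i → X i (g i))) [ z j ]≔ true ∈ edges H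

-- Links and the passage from many edges to a multipartite copy

module _ (H : RGraph (suc q) n) where

  -- The first conjunct keeps `v` out of `u`; it is what later separates the vertices `z j` from the
  -- parts `X i`.
  link : Fin n → Subset n → Bool
  link v u = not (lookup u v) ∧ ⌊ (u [ v ]≔ true) ∈ₗ? edges H ⌋

  degree≤link : ∀ v → count (λ E → lookup E v) (edges H) ≤ count (link v) (subsetsOfSize n q)
  degree≤link v = count-cover _≟ₛ_ (_[ v ]≔ true) (λ E → lookup E v) (link v) (subsetsOfSize n q) (unique H) remove
    where
    remove : ∀ E → E ∈ edges H → v ∈ₛ E → ∃[ u ] (u ∈ subsetsOfSize n q × u [ v ]≔ true ≡ E × link v u ≡ true)
    remove E E∈ v∈ = u , u∈ , restore , cong₂ _∧_ (cong not (lookup∘update v E false)) (isYes⁺ (_ ∈ₗ? edges H) (subst (_∈ edges H) (sym restore) E∈))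
      where
      u = E [ v ]≔ false
      u∈ : u ∈ subsetsOfSize n q
      u∈ = subst (λ k → u ∈ subsetsOfSize n k) (suc-injective (trans (∣delete∣ E v v∈) (All.lookup (uniform H) E∈))) (∈-subsetsOfSize⁺ u)
      restore : u [ v ]≔ true ≡ E
      restore = trans ([]≔-idempotent E v) (trans (cong (E [ v ]≔_) (sym v∈)) ([]≔-lookup E v))

distinct? : (x : Vec (Fin n) q) → Dec (∀ i j → lookup x i ≡ lookup x j → i ≡ j)
distinct? x = all? λ i → all? λ j → (lookup x i ≟F lookup x j) →-dec (i ≟F j)

-- One ordering of each set is enough, as constant factors such as q! may be lost.
subsets≤tuples : (Q : Subset n → Bool) → ∀ q →
  count Q (subsetsOfSize n q) ≤ count (λ x → ⌊ distinct? x ⌋ ∧ Q (support x)) (tuples n q)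
subsets≤tuples {n} Q q = count-cover _≟ₛ_ support Q _ (tuples n q) (subsetsOfSize-unique n q) order
  where
  order : ∀ S → S ∈ subsetsOfSize n q → Q S ≡ true →
    ∃[ x ] (x ∈ tuples n q × support x ≡ S × ⌊ distinct? x ⌋ ∧ Q (support x) ≡ true)
  order S S∈ QS = x , ∈-tuples x , x≡S , cong₂ _∧_ (isYes⁺ (distinct? x) distinct) (trans (cong Q x≡S) QS)
    where
    size = ∈-subsetsOfSize⁻ n q S∈
    x = tabulate (enumAs S size)
    lookup-x : ∀ i → lookup x i ≡ enumAs S size i
    lookup-x = lookup∘tabulate (enumAs S size)
    distinct : ∀ i j → lookup x i ≡ lookup x j → i ≡ j
    distinct i j e = enumAs-injective S size (trans (sym (lookup-x i)) (trans e (lookup-x j)))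
    x≡S : support x ≡ S
    x≡S = subset-ext
      (λ y y∈ → let i , e = ∈-support⁻ x y∈ in subst (_∈ₛ S) (trans (sym (lookup-x i)) e) (enumAs-∈ S size i))
      (λ y y∈ → let i , e = enumAs-surjective S size y∈ in ∈-support⁺ x i (trans (lookup-x i) e))

-- The grid is sought among the orderings of sets in `L`. Its transversals then have distinct
-- entries, which makes the parts disjoint, and lie in the link of every `z j`, which keeps `z j`
-- outside the parts.
link⇒copy : ∀ {c t K} (H : RGraph (suc q) n) (z : Fin c → Fin n) → Injective _≡_ _≡_ z →
  (L : Subset n → Bool) → (∀ u → L u ≡ true → ∀ j → link H (z j) u ≡ true) →
  n ^ q ≤ K * count L (subsetsOfSize n q) → DenseHasGrid n q t K → MultipartiteCopy H c t
link⇒copy {q} {n} {c} {t} {K} H z z-inj L L-ok L-dense grid = record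
  { z = z ; X = X
  ; z-injective = z-inj
  ; X-injective = λ {i} {i′} → X-injective i i′ _ _
  ; z≢X = z≢X
  ; transversal = transversal
  }
  where
  ordered : Vec (Fin n) q → Bool
  ordered x = ⌊ distinct? x ⌋ ∧ L (support x)
  parts : Grid t ordered
  parts = grid ordered (≤-trans L-dense (*-monoʳ-≤ K (subsets≤tuples L q)))
  X : Fin q → Fin t → Fin n
  X = proj₁ parts
  tuple : (Fin q → Fin (t)) → Vec (Fin n) q
  tuple g = tabulate (λ i → X i (g i))
  lookup-tuple : ∀ g i → lookup (tuple g) i ≡ X i (g i)
  lookup-tuple g = lookup∘tabulate (λ i → X i (g i))
  tuple-distinct : ∀ g i j → X i (g i) ≡ X j (g j) → i ≡ j
  tuple-distinct g i j e = isYes⁻ (distinct? (tuple g)) (∧-conicalˡ _ _ (proj₂ (proj₂ parts) g)) i j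
    (trans (lookup-tuple g i) (trans e (sym (lookup-tuple g j))))
  tuple-link : ∀ g j → link H (z j) (support (tuple g)) ≡ true
  tuple-link g = L-ok _ (∧-conicalʳ _ _ (proj₂ (proj₂ parts) g))
  transversal : ∀ j g → support (tuple g) [ z j ]≔ true ∈ edges H
  transversal j g = isYes⁻ (_ ∈ₗ? edges H) (∧-conicalʳ _ _ (tuple-link g j))
  z≢X : ∀ j i a → z j ≢ X i a
  z≢X j i a e = contradiction (trans (cong not (sym (∈-support⁺ (tuple (λ _ → a)) i (trans (lookup-tuple (λ _ → a) i) (sym e)))))
    (∧-conicalˡ _ _ (tuple-link (λ _ → a) j))) λ ()
  X-injective : ∀ i i′ a a′ → X i a ≡ X i′ a′ → i ≡ i′ × a ≡ a′
  X-injective i i′ a a′ e with i ≟F i′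
  ... | yes refl = refl , proj₁ (proj₂ parts) i e
  ... | no i≢i′ = contradiction (tuple-distinct g i i′ (trans (cong (X i) gi) (trans e (cong (X i′) (sym gi′))))) i≢i′
    where
    -- A transversal through both points, whose coincidence would repeat an entry.
    g : Fin q → Fin (t)
    g k with k ≟F i
    ... | yes _ = a
    ... | no _ = a′
    gi : g i ≡ a
    gi with i ≟F i
    ... | yes _ = refl
    ... | no i≢i = contradiction refl i≢i
    gi′ : g i′ ≡ a′
    gi′ with i′ ≟F i
    ... | yes e = contradiction (sym e) i≢i′
    ... | no _ = refl

-- Here `s` is a precision: the edges number more than (1 + 1/(s + 1)) c C(n, q). As `τ` covers
-- them, a q-set lies in more than `c` of the `M` links on average, so `common` finds c + 1 vertices
-- with a dense common link and `link⇒copy` applies.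
dense⇒copy : ∀ q c s t M → 1 ≤ c → ∃[ N ] (∀ n → N ≤ n → (H : RGraph (suc q) n) (τ : Fin M → Fin n) →
  Injective _≡_ _≡_ τ → Covers H τ → (2 + s) * c * (n C q) < suc s * length (edges H) →
  MultipartiteCopy H (suc c) t)
dense⇒copy q c s t M 1≤c = suc (2 * q) ⊔ proj₁ grid , copy
  where
  K = suc s
  -- The factor `density M K` is lost in `common`; the other factors compare C(n, q) with n^q.
  grid = dense⇒grid q t (2 ^ q * q ! * density M K)
  copy : ∀ n → suc (2 * q) ⊔ proj₁ grid ≤ n → (H : RGraph (suc q) n) (τ : Fin M → Fin n) →
    Injective _≡_ _≡_ τ → Covers H τ → (2 + s) * c * (n C q) < suc s * length (edges H) →
    MultipartiteCopy H (suc c) t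
  copy n N≤n H τ τ-inj covers dense = from-common (common M (suc c) K P us (λ _ → true) (n C q) 0<C hyp)
    where
    open ≤-Reasoning
    us = subsetsOfSize n q
    2q<n : 2 * q < n
    2q<n = ≤-trans (m≤m⊔n _ (proj₁ grid)) N≤n
    instance
      n≢0 : NonZero n
      n≢0 = >-nonZero (≤-trans (s≤s z≤n) 2q<n)
    n^q≤ : n ^ q ≤ 2 ^ q * q ! * (n C q)
    n^q≤ = n^q≤K*C q n (<⇒≤ 2q<n)
    0<C : 0 < n C q
    0<C = positive-factor (n C q) (2 ^ q * q !) (≤-trans (m^n>0 n q) (≤-trans n^q≤ (≤-reflexive (*-comm _ (n C q)))))
    P : Fin M → Subset n → Bool
    P i = link H (τ i)
    us≡C : count (λ _ → true) us ≡ n C q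
    us≡C = trans (count-true us) (length-subsetsOfSize n q)
    edges≤ : length (edges H) ≤ sum (λ i → count (P i) us)
    edges≤ = ≤-trans (length≤sum-count (λ i E → lookup E (τ i)) (edges H) covers) (sum-mono (λ i → degree≤link H (τ i)))
    hyp : (n C q) + K * (suc c * count (λ _ → true) us) ≤ K * (sum (λ i → count (P i) us) + count (λ _ → true) us)
    hyp = begin
      b + K * (suc c * count (λ _ → true) us)  ≡⟨ cong (λ a → b + K * (suc c * a)) us≡C ⟩
      -- Since c ≥ 1, the surplus c C(n, q) of K times the number of edges over K c C(n, q) is at
      -- least C(n, q), the `N` given to `common`.
      b + K * (suc c * b)                      ≤⟨ +-monoˡ-≤ (K * (suc c * b)) (m≤n*m b c ⦃ >-nonZero 1≤c ⦄) ⟩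
      c * b + K * (suc c * b)                  ≡⟨ regroup c b s ⟩
      (2 + s) * c * b + K * b                  ≤⟨ +-monoˡ-≤ (K * b) (<⇒≤ dense) ⟩
      K * length (edges H) + K * b             ≤⟨ +-monoˡ-≤ (K * b) (*-monoʳ-≤ K edges≤) ⟩
      K * sum (λ i → count (P i) us) + K * b   ≡⟨ *-distribˡ-+ K (sum (λ i → count (P i) us)) b ⟨
      K * (sum (λ i → count (P i) us) + b)     ≡⟨ cong (λ a → K * (sum (λ i → count (P i) us) + a)) us≡C ⟨
      K * (sum (λ i → count (P i) us) + count (λ _ → true) us) ∎
      where
      b = n C q
      regroup : ∀ c b s → c * b + suc s * (suc c * b) ≡ (2 + s) * c * b + suc s * b
      regroup = solve-∀
    from-common : Σ (Fin (suc c) → Fin M) (λ σ → Injective _≡_ _≡_ σ × Σ (Subset n → Bool) λ L →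
      (∀ u → L u ≡ true → true ≡ true × (∀ j → P (σ j) u ≡ true)) × n C q ≤ density M K * count L us) →
      MultipartiteCopy H (suc c) t
    from-common (σ , σ-inj , L , L-ok , C≤) =
      link⇒copy {K = 2 ^ q * q ! * density M K} H (τ ∘ σ) (σ-inj ∘ τ-inj) L (λ u Lu → proj₂ (L-ok u Lu))
        (≤-trans n^q≤ (≤-trans (*-monoʳ-≤ (2 ^ q * q !) C≤)
          (≤-reflexive (sym (*-assoc (2 ^ q * q !) (density M K) (count L us))))))
        (proj₂ grid n (≤-trans (m≤n⊔m (suc (2 * q)) (proj₁ grid)) N≤n))

-- Embeddings into complete multipartite hypergraphs

-- Colour zero goes to the part z through ι, colour 1 + i to the part X i.
module Rainbow (F : Pattern) {c : ℕ} (κ : Fin (pv F) → Fin (suc q))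
  (rainbow : ∀ e j → ∃[ x ] (x ∈ₛ pedge F e × κ x ≡ j × (∀ x′ → x′ ∈ₛ pedge F e → κ x′ ≡ j → x′ ≡ x)))
  (ι : ∀ x → κ x ≡ zero → Fin c) (ι-injective : ∀ x y p p′ → ι x p ≡ ι y p′ → x ≡ y)
  {H : RGraph (suc q) n} (copy : MultipartiteCopy H c (pv F)) where

  open MultipartiteCopy copy

  -- The colour is a separate argument, with its equation, so that cases can be taken on it while
  -- `ι` keeps an equation about `κ x`. The parts `X i` have size `pv F`, so `x` can take position
  -- `x` in its part and no numbering of a colour class is required there.
  place : ∀ x j → κ x ≡ j → Fin n
  place x zero p = z (ι x p)
  place x (suc i) _ = X i x

  place-injective : ∀ x y j j′ p p′ → place x j p ≡ place y j′ p′ → x ≡ y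
  place-injective x y zero zero p p′ e = ι-injective x y p p′ (z-injective e)
  place-injective x y zero (suc i) p p′ e = contradiction e (z≢X _ i y)
  place-injective x y (suc i) zero p p′ e = contradiction (sym e) (z≢X _ i x)
  place-injective x y (suc i) (suc i′) p p′ e = proj₂ (X-injective e)

  φ : Fin (pv F) → Fin n
  φ x = place x (κ x) refl

  φ≡place : ∀ x j (p : κ x ≡ j) → φ x ≡ place x j p
  φ≡place x _ refl = refl

  module _ (e : Fin (pm F)) where

    rep : Fin (suc q) → Fin (pv F)
    rep j = proj₁ (rainbow e j)

    rep-∈ : ∀ j → rep j ∈ₛ pedge F e
    rep-∈ j = proj₁ (proj₂ (rainbow e j))

    κ-rep : ∀ j → κ (rep j) ≡ j
    κ-rep j = proj₁ (proj₂ (proj₂ (rainbow e j)))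

    rep-unique : ∀ x → x ∈ₛ pedge F e → x ≡ rep (κ x)
    rep-unique x x∈ = proj₂ (proj₂ (proj₂ (rainbow e (κ x)))) x x∈ refl

    tuple : Vec (Fin n) q
    tuple = tabulate (λ i → X i (rep (suc i)))

    apex : Fin n
    apex = z (ι (rep zero) (κ-rep zero))

    φ-rep-zero : φ (rep zero) ≡ apex
    φ-rep-zero = φ≡place (rep zero) zero (κ-rep zero)

    φ-rep-suc : ∀ i → φ (rep (suc i)) ≡ lookup tuple i
    φ-rep-suc i = trans (φ≡place (rep (suc i)) (suc i) (κ-rep (suc i))) (sym (lookup∘tabulate (λ i → X i (rep (suc i))) i))

    φ-rep-∈ : ∀ j → φ (rep j) ∈ₛ support tuple [ apex ]≔ true
    φ-rep-∈ zero = ∈-insert⁺ (support tuple) apex (inj₁ φ-rep-zero)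
    φ-rep-∈ (suc i) = ∈-insert⁺ (support tuple) apex (inj₂ (∈-support⁺ tuple i (sym (φ-rep-suc i))))

    image-edge : image φ (pedge F e) ≡ support tuple [ apex ]≔ true
    image-edge = subset-ext forth back
      where
      forth : ∀ y → y ∈ₛ image φ (pedge F e) → y ∈ₛ support tuple [ apex ]≔ true
      forth y y∈ with x , x∈ , refl ← ∈-image⁻ φ (pedge F e) y∈ =
        subst (λ x → φ x ∈ₛ support tuple [ apex ]≔ true) (sym (rep-unique x x∈)) (φ-rep-∈ (κ x))
      back : ∀ y → y ∈ₛ support tuple [ apex ]≔ true → y ∈ₛ image φ (pedge F e)
      back y y∈ with ∈-insert⁻ (support tuple) apex y∈
      ... | inj₁ y≡ = ∈-image⁺ φ (pedge F e) (rep zero) (rep-∈ zero) (trans φ-rep-zero (sym y≡))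
      ... | inj₂ y∈′ with i , e′ ← ∈-support⁻ tuple y∈′ =
        ∈-image⁺ φ (pedge F e) (rep (suc i)) (rep-∈ (suc i)) (trans (φ-rep-suc i) e′)

  contains : Contains H F
  contains = φ , (λ {x} {y} → place-injective x y _ _ refl refl) ,
    λ e → subst (_∈ edges H) (sym (image-edge e)) (transversal _ (λ i → rep e (suc i)))

-- Rainbow colourings of expansions

avoid : ∀ {m} {a b : Fin (suc (suc m))} → a ≢ b → Fin m → Fin (suc (suc m))
avoid {a = a} a≢b j = punchIn a (punchIn (punchOut a≢b) j)

avoid-injective : ∀ {m} {a b : Fin (suc (suc m))} (a≢b : a ≢ b) → Injective _≡_ _≡_ (avoid a≢b)
avoid-injective {a = a} a≢b e = punchIn-injective _ _ _ (punchIn-injective a _ _ e)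

avoid≢ˡ : ∀ {m} {a b : Fin (suc (suc m))} (a≢b : a ≢ b) j → avoid a≢b j ≢ a
avoid≢ˡ {a = a} a≢b j = punchInᵢ≢i a _

avoid≢ʳ : ∀ {m} {a b : Fin (suc (suc m))} (a≢b : a ≢ b) j → avoid a≢b j ≢ b
avoid≢ʳ {a = a} a≢b j e = punchInᵢ≢i (punchOut a≢b) j
  (punchIn-injective a _ _ (trans e (sym (punchIn-punchOut a≢b))))

avoid-surjective : ∀ {m} {a b : Fin (suc (suc m))} (a≢b : a ≢ b) {c} → c ≢ a → c ≢ b → ∃[ j ] avoid a≢b j ≡ c
avoid-surjective {a = a} {b} a≢b {c} c≢a c≢b = punchOut b′≢c′ , (begin
  punchIn a (punchIn (punchOut a≢b) (punchOut b′≢c′))  ≡⟨ cong (punchIn a) (punchIn-punchOut b′≢c′) ⟩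
  punchIn a (punchOut a≢c)                              ≡⟨ punchIn-punchOut a≢c ⟩
  c                                                     ∎)
  where
  open ≡-Reasoning
  a≢c : a ≢ c
  a≢c = c≢a ∘ sym
  b′≢c′ : punchOut a≢b ≢ punchOut a≢c
  b′≢c′ e = c≢b (trans (sym (punchIn-punchOut a≢c)) (trans (cong (punchIn a) (sym e)) (punchIn-punchOut a≢b)))

module Ends (G : Graph) where

  src tgt : Fin (e G) → Fin (v G)
  src i = proj₁ (ends G i)
  tgt i = proj₂ (ends G i)

  -- The set Z in the definition of m(G), written so that `mCost G W` is ∣ W ∣ + ∣ missed W ∣ by
  -- definition.
  missed : Subset (v G) → Subset (e G)
  missed W = tabulate (λ i → not (lookup W (src i) ∨ lookup W (tgt i)))

  missed-∈⁺ : ∀ (W : Subset (v G)) i → ¬ src i ∈ₛ W → ¬ tgt i ∈ₛ W → i ∈ₛ missed W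
  missed-∈⁺ W i src∉ tgt∉ = ∈-tabulate⁺ (λ i → not (lookup W (src i) ∨ lookup W (tgt i))) i aux
    where
    aux : not (lookup W (src i) ∨ lookup W (tgt i)) ≡ true
    aux with lookup W (src i) | lookup W (tgt i)
    ... | true | _ = contradiction refl src∉
    ... | false | true = contradiction refl tgt∉
    ... | false | false = refl

  missed-∈⁻ : ∀ (W : Subset (v G)) i → i ∈ₛ missed W → ¬ src i ∈ₛ W × ¬ tgt i ∈ₛ W
  missed-∈⁻ W i i∈ = aux (∈-tabulate⁻ (λ i → not (lookup W (src i) ∨ lookup W (tgt i))) i i∈)
    where
    aux : not (lookup W (src i) ∨ lookup W (tgt i)) ≡ true → ¬ src i ∈ₛ W × ¬ tgt i ∈ₛ W
    aux h with lookup W (src i) | lookup W (tgt i)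
    aux () | true | _
    aux () | false | true
    ... | false | false = (λ ()) , (λ ())

-- The uniformity is `suc (suc r′)`, so that `r ∸ 2` computes to `r′`.
module Expansion (G : Graph) (r′ : ℕ) where

  open Ends G

  G^r : Pattern
  G^r = expansion G (suc (suc r′))

  old : Fin (v G) → Fin (pv G^r)
  old x = x ↑ˡ (e G * r′)

  new : Fin (e G) → Fin r′ → Fin (pv G^r)
  new i j = v G ↑ʳ combine i j

  old-injective : Injective _≡_ _≡_ old
  old-injective = ↑ˡ-injective (e G * r′) _ _

  old≢new : ∀ x i j → old x ≢ new i j
  old≢new x i j eq with () ← trans (sym (splitAt-↑ˡ (v G) x (e G * r′)))
    (trans (cong (splitAt (v G)) eq) (splitAt-↑ʳ (v G) (e G * r′) (combine i j)))

  new-injectiveˡ : ∀ {i i′ j j′} → new i j ≡ new i′ j′ → i ≡ i′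
  new-injectiveˡ {i} {i′} {j} {j′} eq = combine-injectiveˡ i j i′ j′ (↑ʳ-injective (v G) _ _ eq)

  data View : Fin (pv G^r) → Set where
    isOld : ∀ x → View (old x)
    isNew : ∀ i j → View (new i j)

  view : ∀ y → View y
  view y = subst View (join-splitAt (v G) (e G * r′) y) (view-join (splitAt (v G) y))
    where
    view-join : ∀ s → View (join (v G) (e G * r′) s)
    view-join (inj₁ x) = isOld x
    view-join (inj₂ w) = subst (λ w → View (v G ↑ʳ w)) (combine-remQuot {e G} r′ w) (isNew _ _)

  joins : Fin (e G) → Fin (v G) ⊎ Fin (e G * r′) → Bool
  joins i (inj₁ x) = ⌊ x ≟F src i ⌋ ∨ ⌊ x ≟F tgt i ⌋
  joins i (inj₂ w) = ⌊ proj₁ (remQuot r′ w) ≟F i ⌋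

  -- The membership function inside expansion has no name in scope; the type of the
  -- declaration pointwise is solved by its use in lookup-pedge.
  pointwise : ∀ i y → _ ≡ joins i (splitAt (v G) y)

  lookup-pedge : ∀ i y → lookup (pedge G^r i) y ≡ joins i (splitAt (v G) y)
  lookup-pedge i y = trans (lookup∘tabulate _ y) (pointwise i y)

  pointwise i y with splitAt (v G) y
  ... | inj₁ x = refl
  ... | inj₂ w = refl

  lookup-old : ∀ i x → lookup (pedge G^r i) (old x) ≡ joins i (inj₁ x)
  lookup-old i x = trans (lookup-pedge i (old x)) (cong (joins i) (splitAt-↑ˡ (v G) x (e G * r′)))

  lookup-new : ∀ i i′ j → lookup (pedge G^r i) (new i′ j) ≡ ⌊ i′ ≟F i ⌋
  lookup-new i i′ j = trans (lookup-pedge i (new i′ j)) (trans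
    (cong (joins i) (splitAt-↑ʳ (v G) (e G * r′) (combine i′ j)))
    (cong (λ p → ⌊ proj₁ p ≟F i ⌋) (remQuot-combine i′ j)))

  old-∈⁺ : ∀ i x → x ≡ src i ⊎ x ≡ tgt i → old x ∈ₛ pedge G^r i
  old-∈⁺ i x (inj₁ x≡) = trans (lookup-old i x) (cong (_∨ ⌊ x ≟F tgt i ⌋) (isYes⁺ (x ≟F src i) x≡))
  old-∈⁺ i x (inj₂ x≡) = trans (lookup-old i x)
    (trans (cong (⌊ x ≟F src i ⌋ ∨_) (isYes⁺ (x ≟F tgt i) x≡)) (∨-zeroʳ ⌊ x ≟F src i ⌋))

  old-∈⁻ : ∀ i x → old x ∈ₛ pedge G^r i → x ≡ src i ⊎ x ≡ tgt i
  old-∈⁻ i x h = [ inj₁ ∘ isYes⁻ (x ≟F src i) , inj₂ ∘ isYes⁻ (x ≟F tgt i) ]′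
    (∨⁻ ⌊ x ≟F src i ⌋ (trans (sym (lookup-old i x)) h))

  new-∈⁺ : ∀ i j → new i j ∈ₛ pedge G^r i
  new-∈⁺ i j = trans (lookup-new i i j) (isYes⁺ (i ≟F i) refl)

  new-∈⁻ : ∀ i i′ j → new i′ j ∈ₛ pedge G^r i → i′ ≡ i
  new-∈⁻ i i′ j h = isYes⁻ (i′ ≟F i) (trans (sym (lookup-new i i′ j)) h)

  -- Colour zero goes to `W`, and a proper colouring with r - 1 colours, shifted by one, to the
  -- other vertices of G. The r - 2 new vertices of an edge receive, through `avoid`, the r - 2
  -- colours not at its ends. Every edge of G^r is then rainbow.
  module Colouring (W : Subset (v G)) (W-indep : Independent G W) (colourable : Colorable G (suc r′)) where

    col = proj₁ colourable

    colour : Bool → Fin (suc r′) → Fin (suc (suc r′))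
    colour true _ = zero
    colour false a = suc a

    κ-old : Fin (v G) → Fin (suc (suc r′))
    κ-old x = colour (lookup W x) (col x)

    κ-old-zero : ∀ x → κ-old x ≡ zero → x ∈ₛ W
    κ-old-zero x h with lookup W x
    ... | true = refl

    ∈⇒κ-old-zero : ∀ {x} → x ∈ₛ W → κ-old x ≡ zero
    ∈⇒κ-old-zero {x} x∈ = cong (λ b → colour b (col x)) x∈

    κ-ends : ∀ i → κ-old (src i) ≢ κ-old (tgt i)
    κ-ends i h with lookup W (src i) in s∈ | lookup W (tgt i) in t∈
    ... | true | true = W-indep i (s∈ , t∈)
    ... | false | false = proj₂ colourable i (sucF-injective h)

    κ-sum : Fin (v G) ⊎ Fin (e G * r′) → Fin (suc (suc r′))
    κ-sum (inj₁ x) = κ-old x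
    κ-sum (inj₂ w) = let i , j = remQuot r′ w in avoid (κ-ends i) j

    κ : Fin (pv G^r) → Fin (suc (suc r′))
    κ y = κ-sum (splitAt (v G) y)

    κ≡old : ∀ x → κ (old x) ≡ κ-old x
    κ≡old x = cong κ-sum (splitAt-↑ˡ (v G) x (e G * r′))

    κ≡new : ∀ i j → κ (new i j) ≡ avoid (κ-ends i) j
    κ≡new i j = trans (cong κ-sum (splitAt-↑ʳ (v G) (e G * r′) (combine i j)))
      (cong (λ (i , j) → avoid (κ-ends i) j) (remQuot-combine i j))

    rainbow : ∀ i j → ∃[ y ] (y ∈ₛ pedge G^r i × κ y ≡ j × (∀ y′ → y′ ∈ₛ pedge G^r i → κ y′ ≡ j → y′ ≡ y))
    rainbow i j with κ-old (src i) ≟F j | κ-old (tgt i) ≟F j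
    ... | yes refl | _ = old (src i) , old-∈⁺ i (src i) (inj₁ refl) , κ≡old (src i) , λ y → only y (view y)
      where
      only : ∀ y → View y → y ∈ₛ pedge G^r i → κ y ≡ κ-old (src i) → y ≡ old (src i)
      only _ (isOld x) y∈ κy with old-∈⁻ i x y∈
      ... | inj₁ refl = refl
      ... | inj₂ refl = contradiction (trans (sym κy) (κ≡old (tgt i))) (κ-ends i)
      only _ (isNew i′ k) y∈ κy with refl ← new-∈⁻ i i′ k y∈ =
        contradiction (trans (sym (κ≡new i k)) κy) (avoid≢ˡ (κ-ends i) k)
    ... | no _ | yes refl = old (tgt i) , old-∈⁺ i (tgt i) (inj₂ refl) , κ≡old (tgt i) , λ y → only y (view y)
      where
      only : ∀ y → View y → y ∈ₛ pedge G^r i → κ y ≡ κ-old (tgt i) → y ≡ old (tgt i)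
      only _ (isOld x) y∈ κy with old-∈⁻ i x y∈
      ... | inj₁ refl = contradiction (trans (sym (κ≡old (src i))) κy) (κ-ends i)
      ... | inj₂ refl = refl
      only _ (isNew i′ k) y∈ κy with refl ← new-∈⁻ i i′ k y∈ =
        contradiction (trans (sym (κ≡new i k)) κy) (avoid≢ʳ (κ-ends i) k)
    ... | no src≢ | no tgt≢ with k , refl ← avoid-surjective (κ-ends i) (src≢ ∘ sym) (tgt≢ ∘ sym) =
      new i k , new-∈⁺ i k , κ≡new i k , λ y → only y (view y)
      where
      only : ∀ y → View y → y ∈ₛ pedge G^r i → κ y ≡ avoid (κ-ends i) k → y ≡ new i k
      only _ (isOld x) y∈ κy with old-∈⁻ i x y∈
      ... | inj₁ refl = contradiction (trans (sym (κ≡old (src i))) κy) src≢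
      ... | inj₂ refl = contradiction (trans (sym (κ≡old (tgt i))) κy) tgt≢
      only _ (isNew i′ k′) y∈ κy with refl ← new-∈⁻ i i′ k′ y∈ =
        cong (new i) (avoid-injective (κ-ends i) (trans (sym (κ≡new i k′)) κy))

    -- An end in `W` would already have colour zero, which `avoid` excludes for the new vertices.
    new-zero : ∀ i j → κ (new i j) ≡ zero → i ∈ₛ missed W
    new-zero i j h = missed-∈⁺ W i
      (λ s∈ → avoid≢ˡ (κ-ends i) j (trans (sym (κ≡new i j)) (trans h (sym (∈⇒κ-old-zero s∈)))))
      (λ t∈ → avoid≢ʳ (κ-ends i) j (trans (sym (κ≡new i j)) (trans h (sym (∈⇒κ-old-zero t∈)))))

    ι-view : ∀ {y} → View y → κ y ≡ zero → Fin ∣ W ∣ ⊎ Fin ∣ missed W ∣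
    ι-view (isOld x) h = inj₁ (index W (κ-old-zero x (trans (sym (κ≡old x)) h)))
    ι-view (isNew i j) h = inj₂ (index (missed W) (new-zero i j h))

    ι-view-injective : ∀ {x y} (s : View x) (t : View y) p p′ → ι-view s p ≡ ι-view t p′ → x ≡ y
    ι-view-injective (isOld x) (isOld y) p p′ h = cong old (index-injective W _ _ (inj₁-injective h))
    -- A new vertex of colour zero is recorded only by its edge; this loses nothing, as the new
    -- vertices of one edge have different colours.
    ι-view-injective (isNew i j) (isNew i′ j′) p p′ h with refl ← index-injective (missed W) _ _ (inj₂-injective h) =
      cong (new i) (avoid-injective (κ-ends i) (trans (sym (κ≡new i j)) (trans (trans p (sym p′)) (κ≡new i j′))))

    ι : ∀ y → κ y ≡ zero → Fin (mCost G W)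
    ι y p = join ∣ W ∣ ∣ missed W ∣ (ι-view (view y) p)

    ι-injective : ∀ x y p p′ → ι x p ≡ ι y p′ → x ≡ y
    ι-injective x y p p′ h = ι-view-injective (view x) (view y) p p′
      (trans (sym (splitAt-join ∣ W ∣ _ _)) (trans (cong (splitAt ∣ W ∣) h) (splitAt-join ∣ W ∣ _ _)))

    contains-expansion : {H : RGraph (suc (suc r′)) n} → MultipartiteCopy H (mCost G W) (pv G^r) → Contains H G^r
    contains-expansion = Rainbow.contains G^r κ rainbow ι ι-injective

≤1⇒unique : n ≤ 1 → (i j : Fin n) → i ≡ j
≤1⇒unique (s≤s z≤n) zero zero = refl

-- At cost at most one, either no edge is missed and `W` against its complement is a proper
-- 2-colouring, or `W` is empty and G has a single edge. This makes m(G) - 1 positive.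
2≤mCost : (G : Graph) → ¬ Colorable G 2 → ∀ W → Independent G W → 2 ≤ mCost G W
2≤mCost G ¬2col W indep = ≰⇒> λ le → ¬2col (colouring le)
  where
  open Ends G
  same : mCost G W ≤ 1 → (a b : Fin ∣ W ∣ ⊎ Fin ∣ missed W ∣) → a ≡ b
  same le a b = trans (sym (splitAt-join ∣ W ∣ _ a)) (trans (cong (splitAt ∣ W ∣) (≤1⇒unique le (join _ _ a) (join _ _ b))) (splitAt-join ∣ W ∣ _ b))

  bit : Bool → Fin 2
  bit true = zero
  bit false = suc zero

  colouring : mCost G W ≤ 1 → Colorable G 2
  colouring le with anyᶠ? (λ i → lookup (missed W) i ≟B true)
  ... | no none = bit ∘ lookup W , proper
    where
    proper : ∀ i → bit (lookup W (src i)) ≢ bit (lookup W (tgt i))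
    proper i with lookup W (src i) in s∈ | lookup W (tgt i) in t∈
    ... | true | true = contradiction (s∈ , t∈) (indep i)
    ... | true | false = λ ()
    ... | false | true = λ ()
    ... | false | false = contradiction (i , missed-∈⁺ W i (λ h → contradiction (trans (sym s∈) h) λ ()) (λ h → contradiction (trans (sym t∈) h) λ ())) none
  ... | yes (i₀ , i₀∈) = (λ x → bit ⌊ x ≟F src i₀ ⌋) , proper
    where
    empty : ∀ x → ¬ x ∈ₛ W
    empty x x∈ with () ← same le (inj₁ (index W x∈)) (inj₂ (index (missed W) i₀∈))
    only : ∀ i → i ≡ i₀
    only i with i∈ ← missed-∈⁺ W i (empty (src i)) (empty (tgt i))
      with same le (inj₂ (index (missed W) i∈)) (inj₂ (index (missed W) i₀∈))
    ... | e = index-injective (missed W) i∈ i₀∈ (inj₂-injective e)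
    proper : ∀ i → bit ⌊ src i ≟F src i₀ ⌋ ≢ bit ⌊ tgt i ≟F src i₀ ⌋
    proper i with refl ← only i with src i ≟F src i | tgt i ≟F src i
    ... | yes _ | no _ = λ ()
    ... | yes _ | yes e = contradiction (sym e) (loopless G i)
    ... | no s≢s | _ = contradiction refl s≢s

∣++∣ : (S : Subset p) (T : Subset q) → ∣ S ++ᵛ T ∣ ≡ ∣ S ∣ + ∣ T ∣
∣++∣ [] T = refl
∣++∣ (true ∷ S) T = cong suc (∣++∣ S T)
∣++∣ (false ∷ S) T = ∣++∣ S T

length-cartesianProductWith : ∀ {A B C : Set} (f : A → B → C) xs ys → length (cartesianProductWith f xs ys) ≡ length xs * length ys
length-cartesianProductWith f [] ys = refl
length-cartesianProductWith f (x ∷ xs) ys = trans (length-++ (map (f x) ys))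
  (cong₂ _+_ (length-map (f x) ys) (length-cartesianProductWith f xs ys))

-- The lower bound

-- The vertices split as c + m with the centres first, so that the edge set is a product of centres
-- with q-sets and its size is immediate.
module Star (c m q : ℕ) where

  spoke : Fin c → Subset m → Subset (c + m)
  spoke i u = ⁅ i ⁆ ++ᵛ u

  ∈-⁅⁆⁺ : ∀ {c} (i : Fin c) → i ∈ₛ ⁅ i ⁆
  ∈-⁅⁆⁺ i = []=⇒lookup (x∈⁅x⁆ i)

  ∈-⁅⁆⁻ : ∀ {c} {i : Fin c} j → i ∈ₛ ⁅ j ⁆ → i ≡ j
  ∈-⁅⁆⁻ {i = i} j i∈ = x∈⁅y⁆⇒x≡y j (lookup⇒[]= i _ i∈)

  spoke-injective : ∀ {i i′ u u′} → spoke i u ≡ spoke i′ u′ → i ≡ i′ × u ≡ u′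
  spoke-injective {i} {i′} eq with ⁅i⁆≡ , u≡ ← ++-injective ⁅ i ⁆ ⁅ i′ ⁆ eq =
    ∈-⁅⁆⁻ i′ (subst (i ∈ₛ_) ⁅i⁆≡ (∈-⁅⁆⁺ i)) , u≡

  spokes : List (Subset (c + m))
  spokes = cartesianProductWith spoke (allFin c) (subsetsOfSize m q)

  spokes⁻ : ∀ {E} → E ∈ spokes → ∃[ i ] ∃[ u ] (u ∈ subsetsOfSize m q × E ≡ spoke i u)
  spokes⁻ E∈ with i , u , _ , u∈ , e ← ∈-cartesianProductWith⁻ spoke (allFin c) (subsetsOfSize m q) E∈ = i , u , u∈ , e

  star : RGraph (suc q) (c + m)
  star = record
    { edges = spokes
    ; unique = Unique.cartesianProductWith⁺ spoke spoke-injective (Unique.allFin⁺ c) (subsetsOfSize-unique m q)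
    ; uniform = All.tabulate (size ∘ spokes⁻)
    }
    where
    size : ∀ {E} → ∃[ i ] ∃[ u ] (u ∈ subsetsOfSize m q × E ≡ spoke i u) → ∣ E ∣ ≡ suc q
    size (i , u , u∈ , refl) = trans (∣++∣ ⁅ i ⁆ u) (cong₂ _+_ (∣⁅x⁆∣≡1 i) (∈-subsetsOfSize⁻ m q u∈))

  length-star : length (edges star) ≡ c * (m C q)
  length-star = trans (length-cartesianProductWith spoke (allFin c) (subsetsOfSize m q))
    (cong₂ _*_ (length-tabulate {n = c} _) (length-subsetsOfSize m q))

  centre : ∀ {E} → E ∈ edges star → ∃[ i ] ((i ↑ˡ m) ∈ₛ E × (∀ j → (j ↑ˡ m) ∈ₛ E → j ≡ i))
  centre E∈ with i , u , _ , refl ← spokes⁻ E∈ =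
    i , trans (lookup-++ˡ ⁅ i ⁆ u i) (∈-⁅⁆⁺ i) , λ j j∈ → ∈-⁅⁆⁻ i (trans (sym (lookup-++ˡ ⁅ i ⁆ u j)) j∈)

  -- Each edge of a copy has exactly one centre, its `hub`. Both freeness proofs count by an
  -- injection into the centres built from hubs.
  module Copy (F : Pattern) (φ : Fin (pv F) → Fin (c + m)) (φ-edge : ∀ k → image φ (pedge F k) ∈ edges star) where

    hub : Fin (pm F) → Fin c
    hub k = proj₁ (centre (φ-edge k))

    hub-preimage : ∀ k → ∃[ x ] (x ∈ₛ pedge F k × φ x ≡ hub k ↑ˡ m)
    hub-preimage k = ∈-image⁻ φ (pedge F k) (proj₁ (proj₂ (centre (φ-edge k))))

    hub-unique : ∀ k x i → x ∈ₛ pedge F k → φ x ≡ i ↑ˡ m → i ≡ hub k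
    hub-unique k x i x∈ e = proj₂ (proj₂ (centre (φ-edge k))) i (∈-image⁺ φ (pedge F k) x x∈ e)

  matching-free : ∀ s → c ≤ s → ¬ Contains star (matching (suc s) (suc q))
  matching-free s c≤s (φ , φ-inj , φ-edge) = contradiction (≤-trans (injective⇒≤ hub-injective) c≤s) (<⇒≱ ≤-refl)
    where
    F = matching (suc s) (suc q)
    open Copy F φ φ-edge
    block : ∀ k y → y ∈ₛ pedge F k → proj₁ (remQuot {suc s} (suc q) y) ≡ k
    block k y y∈ = isYes⁻ (proj₁ (remQuot {suc s} (suc q) y) ≟F k) (∈-tabulate⁻ (λ y → ⌊ proj₁ (remQuot {suc s} (suc q) y) ≟F k ⌋) y y∈)
    hub-injective : Injective _≡_ _≡_ hub
    hub-injective {k} {k′} e with x , x∈ , φx ← hub-preimage k | x′ , x′∈ , φx′ ← hub-preimage k′ =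
      trans (sym (block k x x∈)) (trans (cong (proj₁ ∘ remQuot {suc s} (suc q)) (φ-inj (trans φx (trans (cong (_↑ˡ m) e) (sym φx′))))) (block k′ x′ x′∈))

module _ (G : Graph) (r′ c m : ℕ) where

  open Ends G
  open Expansion G r′
  open Star c m (suc r′)

  -- `W` consists of the vertices of G sent to centres, and is independent because an edge has only
  -- one centre. An edge missed by `W` has its centre at a new vertex, which lies in no other edge.
  -- Thus `W` and the missed edges together inject into the `c` centres.
  contains⇒mCost≤ : Contains star G^r → ∃[ W ] (Independent G W × mCost G W ≤ c)
  contains⇒mCost≤ (φ , φ-inj , φ-edge) = W , W-indep , injective⇒≤ {f = centre-of ∘ splitAt ∣ W ∣} λ {a} {b} eq →
      trans (sym (join-splitAt ∣ W ∣ _ a)) (trans (cong (join ∣ W ∣ _) (distinct (splitAt ∣ W ∣ a) (splitAt ∣ W ∣ b) eq)) (join-splitAt ∣ W ∣ _ b))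
    where
    open Copy G^r φ φ-edge
    central? : ∀ x → Dec (∃[ i ] φ (old x) ≡ i ↑ˡ m)
    central? x = anyᶠ? (λ i → φ (old x) ≟F (i ↑ˡ m))
    W : Subset (v G)
    W = tabulate (λ x → ⌊ central? x ⌋)
    W⁺ : ∀ x i → φ (old x) ≡ i ↑ˡ m → x ∈ₛ W
    W⁺ x i e = ∈-tabulate⁺ (λ x → ⌊ central? x ⌋) x (isYes⁺ (central? x) (i , e))
    W⁻ : ∀ x → x ∈ₛ W → ∃[ i ] φ (old x) ≡ i ↑ˡ m
    W⁻ x x∈ = isYes⁻ (central? x) (∈-tabulate⁻ (λ x → ⌊ central? x ⌋) x x∈)

    W-indep : Independent G W
    W-indep k (s∈ , t∈) with i , φs ← W⁻ (src k) s∈ | j , φt ← W⁻ (tgt k) t∈ =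
      loopless G k (old-injective (φ-inj (trans φs (trans (cong (_↑ˡ m) i≡j) (sym φt)))))
      where
      i≡j : i ≡ j
      i≡j = trans (hub-unique k (old (src k)) i (old-∈⁺ k (src k) (inj₁ refl)) φs)
        (sym (hub-unique k (old (tgt k)) j (old-∈⁺ k (tgt k) (inj₂ refl)) φt))

    new-centre : ∀ k → k ∈ₛ missed W → ∃[ j ] φ (new k j) ≡ hub k ↑ˡ m
    new-centre k k∈ with y , y∈ , φy ← hub-preimage k = from-view (view y) y∈ φy
      where
      from-view : ∀ {y} → View y → y ∈ₛ pedge G^r k → φ y ≡ hub k ↑ˡ m → ∃[ j ] φ (new k j) ≡ hub k ↑ˡ m
      from-view (isOld x) y∈ φy with old-∈⁻ k x y∈
      ... | inj₁ refl = contradiction (W⁺ _ _ φy) (proj₁ (missed-∈⁻ W k k∈))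
      ... | inj₂ refl = contradiction (W⁺ _ _ φy) (proj₂ (missed-∈⁻ W k k∈))
      from-view (isNew k′ j) y∈ φy with refl ← new-∈⁻ k k′ j y∈ = j , φy

    centre-of : Fin ∣ W ∣ ⊎ Fin ∣ missed W ∣ → Fin c
    centre-of (inj₁ a) = proj₁ (W⁻ _ (enum-∈ W a))
    centre-of (inj₂ b) = hub (enum (missed W) b)

    distinct : ∀ a b → centre-of a ≡ centre-of b → a ≡ b
    distinct (inj₁ a) (inj₁ a′) eq = cong inj₁ (enum-injective W (old-injective (φ-inj
      (trans (proj₂ (W⁻ _ (enum-∈ W a))) (trans (cong (_↑ˡ m) eq) (sym (proj₂ (W⁻ _ (enum-∈ W a′)))))))))
    distinct (inj₁ a) (inj₂ b) eq with j , φj ← new-centre _ (enum-∈ (missed W) b) =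
      contradiction (φ-inj (trans (proj₂ (W⁻ _ (enum-∈ W a))) (trans (cong (_↑ˡ m) eq) (sym φj)))) (old≢new _ _ _)
    distinct (inj₂ b) (inj₁ a) eq with j , φj ← new-centre _ (enum-∈ (missed W) b) =
      contradiction (φ-inj (trans (proj₂ (W⁻ _ (enum-∈ W a))) (trans (cong (_↑ˡ m) (sym eq)) (sym φj)))) (old≢new _ _ _)
    distinct (inj₂ b) (inj₂ b′) eq with j , φj ← new-centre _ (enum-∈ (missed W) b) | j′ , φj′ ← new-centre _ (enum-∈ (missed W) b′) =
      cong inj₂ (enum-injective (missed W) (new-injectiveˡ (φ-inj (trans φj (trans (cong (_↑ˡ m) eq) (sym φj′))))))

-- The upper bound, and the size of the star

copy⇒matching : ∀ {s} {H : RGraph (suc q) n} → MultipartiteCopy H (suc s) (suc s) → Contains H (matching (suc s) (suc q))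
copy⇒matching {q} {n} {s} {H} copy = contains-matching H D (λ j → transversal j (λ _ → j)) disjoint
  where
  open MultipartiteCopy copy
  row : Fin (suc s) → Vec (Fin n) q
  row j = tabulate (λ i → X i j)
  -- Edge `j` takes the `j`-th vertex of every part, so different edges share no vertex.
  D : Fin (suc s) → Subset n
  D j = support (row j) [ z j ]≔ true
  D⁻ : ∀ j {x} → x ∈ₛ D j → x ≡ z j ⊎ ∃[ i ] x ≡ X i j
  D⁻ j x∈ with ∈-insert⁻ (support (row j)) (z j) x∈
  ... | inj₁ x≡ = inj₁ x≡
  ... | inj₂ x∈′ with i , e ← ∈-support⁻ (row j) x∈′ = inj₂ (i , trans (sym e) (lookup∘tabulate (λ i → X i j) i))
  disjoint : PairwiseDisjoint D
  disjoint j j′ x∈ x∈′ with D⁻ j x∈ | D⁻ j′ x∈′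
  ... | inj₁ refl | inj₁ e = z-injective e
  ... | inj₁ refl | inj₂ (i , e) = contradiction e (z≢X j i j′)
  ... | inj₂ (i , refl) | inj₁ e = contradiction (sym e) (z≢X j′ i j)
  ... | inj₂ (i , refl) | inj₂ (i′ , e) = proj₂ (X-injective e)

-- The contrapositive of `dense⇒copy`, applied to the cover left by a packing of i ≤ s edges. The
-- threshold there depends on the cover size i (q + 1), so the thresholds are summed over all i ≤ s.
copy-free⇒upper : ∀ q c s t a → 1 ≤ c → ∃[ N ] (∀ n → N ≤ n → (H : RGraph (suc q) n) →
  ¬ Contains H (matching (suc s) (suc q)) → ¬ MultipartiteCopy H (suc c) a →
  suc t * length (edges H) ≤ (2 + t) * c * (n C q))
copy-free⇒upper q c s t a 1≤c = sum threshold , bound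
  where
  copies : ∀ i → _
  copies i = dense⇒copy q c t a (i * suc q) 1≤c
  threshold : Fin (suc s) → ℕ
  threshold i = proj₁ (copies (toℕ i))
  bound : ∀ n → sum threshold ≤ n → (H : RGraph (suc q) n) →
    ¬ Contains H (matching (suc s) (suc q)) → ¬ MultipartiteCopy H (suc c) a →
    suc t * length (edges H) ≤ (2 + t) * c * (n C q)
  bound n N≤n H ¬matching ¬copy with packing-or-cover H (suc s)
  ... | inj₁ (D , D∈ , disjoint) = contradiction (contains-matching H D D∈ disjoint) ¬matching
  ... | inj₂ (i , i<1+s , τ , τ-inj , covers) = ≮⇒≥ λ dense →
    ¬copy (proj₂ (copies i) n (≤-trans threshold≤ N≤n) H τ τ-inj covers dense)
    where
    threshold≤ : proj₁ (copies i) ≤ sum threshold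
    threshold≤ = subst (λ i → proj₁ (copies i) ≤ sum threshold) (toℕ-fromℕ< i<1+s) (term≤sum threshold (fromℕ< i<1+s))

-- `C-shift` with a = t c and j = c bounds the loss from n to n - c vertices by the factor (t c + c)
-- / (t c) = (t + 1) / t.
star-lower : ∀ q c t → ∃[ N ] (∀ n → N ≤ n → ∃[ m ] (c + m ≡ n × t * c * (n C q) ≤ suc t * (c * (m C q))))
star-lower q c t = c + (t * c + c) * q , λ n N≤n → bound n N≤n
  where
  bound : ∀ n → c + (t * c + c) * q ≤ n → ∃[ m ] (c + m ≡ n × t * c * (n C q) ≤ suc t * (c * (m C q)))
  bound n N≤n = n ∸ c , c+m≡n , (begin
    t * c * (n C q)                  ≡⟨ cong (λ n → t * c * (n C q)) c+m≡n ⟨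
    t * c * ((c + (n ∸ c)) C q)      ≤⟨ C-shift (t * c) c (n ∸ c) q large ⟩
    (t * c + c) * ((n ∸ c) C q)      ≡⟨ regroup t c ((n ∸ c) C q) ⟩
    suc t * (c * ((n ∸ c) C q))      ∎)
    where
    open ≤-Reasoning
    c+m≡n : c + (n ∸ c) ≡ n
    c+m≡n = m+[n∸m]≡n (≤-trans (m≤m+n c _) N≤n)
    large : (t * c + c) * q ≤ suc (n ∸ c)
    large = m≤n⇒m≤1+n (+-cancelˡ-≤ c _ _ (≤-trans N≤n (≤-reflexive (sym c+m≡n))))
    regroup : ∀ t c b → (t * c + c) * b ≡ suc t * (c * b)
    regroup = solve-∀

-- The asymptotic

-- For positive c C(n, r-1) the two inequalities say that ex / (c C(n, r-1)) is within 1/(t + 1) of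
-- 1; having this for every `t` is the factor 1 + o(1).
Asymptotic : Graph → ℕ → ℕ → ℕ → ℕ → Set
Asymptotic G r s t c = ∃[ N ] (∀ n → N ≤ n → ∀ ex → IsEx2 r n (expansion G r) (matching (suc s) r) ex →
  t * c * (n C (r ∸ 1)) ≤ suc t * ex × suc t * ex ≤ (2 + t) * c * (n C (r ∸ 1)))

-- Common to both values of the minimum: c ≤ s and c < m(G) make the star an admissible hypergraph,
-- while `embed` carries whichever forbidden pattern a copy with small part c + 1 contains.
asymptotic : ∀ G r′ s t c → 1 ≤ c → c ≤ s → (∀ W → Independent G W → c < mCost G W) →
  ∀ a → (∀ {n} (H : RGraph (2 + r′) n) → MultipartiteCopy H (suc c) a →
    Contains H (expansion G (2 + r′)) ⊎ Contains H (matching (suc s) (2 + r′))) →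
  Asymptotic G (2 + r′) s t c
asymptotic G r′ s t c 1≤c c≤s c<mCost a embed = proj₁ lower ⊔ proj₁ upper , bounds
  where
  lower = star-lower (suc r′) c t
  upper = copy-free⇒upper (suc r′) c s t a 1≤c
  bounds : ∀ n → proj₁ lower ⊔ proj₁ upper ≤ n → ∀ ex → IsEx2 (2 + r′) n (expansion G (2 + r′)) (matching (suc s) (2 + r′)) ex →
    t * c * (n C suc r′) ≤ suc t * ex × suc t * ex ≤ (2 + t) * c * (n C suc r′)
  bounds n N≤n ex isEx@((H , (¬G^r , ¬matching) , length≡) , _) = below , above
    where
    below : t * c * (n C suc r′) ≤ suc t * ex
    below with m , c+m≡n , le ← proj₂ lower n (≤-trans (m≤m⊔n _ (proj₁ upper)) N≤n) =
      ≤-trans le (*-monoʳ-≤ (suc t) (star≤ex m (subst (λ n → IsEx2 (2 + r′) n (expansion G (2 + r′)) (matching (suc s) (2 + r′)) ex) (sym c+m≡n) isEx)))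
      where
      star≤ex : ∀ m → IsEx2 (2 + r′) (c + m) (expansion G (2 + r′)) (matching (suc s) (2 + r′)) ex → c * (m C suc r′) ≤ ex
      star≤ex m (_ , maximal) = subst (_≤ ex) length-star (maximal star (¬expansion , matching-free s c≤s))
        where
        open Star c m (suc r′)
        ¬expansion : ¬ Contains star (expansion G (2 + r′))
        ¬expansion copy with W , W-indep , le ← contains⇒mCost≤ G r′ c m copy = <⇒≱ (c<mCost W W-indep) le
    above : suc t * ex ≤ (2 + t) * c * (n C suc r′)
    above = subst (λ ex → suc t * ex ≤ (2 + t) * c * (n C suc r′)) length≡
      (proj₂ upper n (≤-trans (m≤n⊔m (proj₁ lower) _) N≤n) H ¬matching
        λ copy → [ ¬G^r , ¬matching ]′ (embed H copy))

theorem1p9 : (r s k : ℕ) (G : Graph) → 1 ≤ s → ChromaticNumber G k → 2 < k → k < r →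
    (mG : ℕ) → IsM G mG →
    (t : ℕ) → Σ ℕ λ N → (n : ℕ) → N ≤ n → (ex : ℕ) →
    IsEx2 r n (expansion G r) (matching (suc s) r) ex →
    (t * ((mG ∸ 1) ⊓ s) * (n C (r ∸ 1)) ≤ suc t * ex)
    × (suc t * ex ≤ (2 + t) * ((mG ∸ 1) ⊓ s) * (n C (r ∸ 1)))
theorem1p9 (suc zero) s k G 1≤s χ 2<k (s≤s k≤0) mG isM t = contradiction (≤-trans 2<k k≤0) λ ()
theorem1p9 (suc (suc r′)) s k G 1≤s (k-colouring , k-minimal) 2<k (s≤s k≤q) mG ((W , W-indep , cost≡) , minimal) t =
  -- As χ(G) > 2, m(G) is at least 2, so the minimum is positive as `asymptotic` requires.
  result mG (subst (2 ≤_) cost≡ (2≤mCost G (k-minimal 2 2<k) W W-indep)) cost≡ minimal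
  where
  open Expansion G r′
  q-colouring : Colorable G (suc r′)
  q-colouring = (λ x → inject≤ (proj₁ k-colouring x) k≤q) ,
    λ i eq → proj₂ k-colouring i (inject≤-injective k≤q k≤q _ _ eq)
  open Colouring W W-indep q-colouring
  result : ∀ mG → 2 ≤ mG → mCost G W ≡ mG → (∀ W → Independent G W → mG ≤ mCost G W) →
    Asymptotic G (2 + r′) s t ((mG ∸ 1) ⊓ s)
  result (suc m) (s≤s 1≤m) cost≡ minimal with ≤-total m s
  ... | inj₁ m≤s = subst (Asymptotic G (2 + r′) s t) (sym (m≤n⇒m⊓n≡m m≤s))
    -- Here c + 1 = m(G) is the cost of the optimal `W`, exactly the room that colour zero takes.
    (asymptotic G r′ s t m 1≤m m≤s minimal (pv G^r) (λ H copy →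
      inj₁ (contains-expansion (subst (λ c → MultipartiteCopy H c (pv G^r)) (sym cost≡) copy))))
  ... | inj₂ s≤m = subst (Asymptotic G (2 + r′) s t) (sym (m≥n⇒m⊓n≡n s≤m))
    -- Parts of size s + 1 suffice, each edge of the matching taking one vertex from every part.
    (asymptotic G r′ s t s 1≤s ≤-refl (λ W i → ≤-trans (s≤s s≤m) (minimal W i)) (suc s) (λ H copy → inj₂ (copy⇒matching copy)))
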